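{- For every nonnegative integer $n$, every integer $\alpha\ge 4$, and every integer $j$ with $0\le j\le (\alpha-4)/2$, $$\overline{A}_{5^\alpha}\bigl(5^{2j}(625n+i)\bigr)\equiv 0 \pmod{5}\qquad\text{for } i\in\{125,500\}.$$
   Context: An overpartition of $n$ is a partition of $n$ in which the first occurrence of each distinct part may be overlined. For a positive integer $\ell$, $\overline{A}_\ell(n)$ denotes the number of overpartitions of $n$ into parts not divisible by $\ell$, with $\overline{A}_\ell(0)=1$; equivalently $$\sum_{n\ge 0}\overline{A}_\ell(n)q^n=\frac{(q^\ell;q^\ell)_\infty^2(q^2;q^2)_\infty}{(q;q)_\infty^2(q^{2\ell};q^{2\ell})_\infty},\qquad (a;q)_\infty=\prod_{k\ge 0}(1-aq^k).$$ -}

module Defs where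

open import Data.Nat using (ℕ; zero; suc; _+_; _*_; _∸_; _≤?_)
open import Data.Nat.Divisibility using (_∣?_)
open import Relation.Nullary using (yes; no)

sumFrom1 : ℕ → (ℕ → ℕ) → ℕ
sumFrom1 zero    f = 0
sumFrom1 (suc c) f = sumFrom1 c f + f (suc c)

-- ovCount ℓ m n = number of overpartitions of n whose parts all lie in
-- {1,…,m} and are not divisible by ℓ.
-- Recursion on the largest allowed part size m: part size p = suc k is
-- either forbidden (ℓ ∣ p), or occurs with multiplicity c ≥ 0; multiplicity 0
-- gives 1 choice, multiplicity c ≥ 1 gives 2 choices (first occurrence
-- overlined or not).
ovCount : ℕ → ℕ → ℕ → ℕ
ovCount ℓ zero    zero    = 1
ovCount ℓ zero    (suc n) = 0
ovCount ℓ (suc k) n with ℓ ∣? suc k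
... | yes _ = ovCount ℓ k n
... | no  _ = ovCount ℓ k n + 2 * sumFrom1 n term
  where
  term : ℕ → ℕ
  term c with c * suc k ≤? n
  ... | yes _ = ovCount ℓ k (n ∸ c * suc k)
  ... | no  _ = 0

Abar : ℕ → ℕ → ℕ
Abar ℓ n = ovCount ℓ n n

{-# OPTIONS --safe #-}
module Submission where

-- Let φ = Σ_{k ∈ ℤ} (-1)ᵏ q^{k²}.  By Gauss' identity Σ Abar ℓ n qⁿ = φ(q^ℓ) / φ(q), which modulo 5
-- is φ^ℓ / φ for ℓ = 5^α.  Let F f = f⁵, so that F f (q) = f(q⁵) modulo 5, and let U keep the
-- exponents divisible by 5, Σ aₙ qⁿ ↦ Σ a₅ₙ qⁿ; then U (F f · g) = f · U g.  Sorting k by its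
-- residue modulo 5 gives φ = F²φ + 2β + 2γ, where the exponents in β and γ are ≡ 1 and ≡ 4 (mod 5);
-- sorting the Gaussian integers by their residue modulo 2 + i gives (Fφ)² = (F²φ)² + 4βγ.
-- Expanding powers of φ modulo 5 yields U φ⁴ = φ⁴, U φ³ = Fφ · φ² and U φ² = 2φ² - F(φ²).  Hence, for
-- H = φ (2φ² - F(φ²)), U³ (F³ξ / φ) = ξ H and U² (F²ξ · H) = ξ H, so that applying U 3 + 2j times to
-- φ^ℓ / φ gives F^{α-3-2j} φ · H.  This has no exponents ≡ ±1 (mod 5), because H has none and
-- α > 3 + 2j.

-- The indices are 5^{2j} · 125 · (5n ± 1), so `U` is applied three times for the factor 125 and
-- twice more for each step of j; the residues ±1 that remain are the classes missing from H. The
-- product H is found by following `U`: the operator exchanges H and Fφ · φ², and the first two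
-- applications to the quotient lead into this 2-cycle. Each application consumes one F. One F must
-- be left over: its factor then has only exponents divisible by 5 and cannot move the classes of H.
--
-- The obstacle is that theta series and products are infinite. Both are treated in rings where a
-- power of q vanishes. Modulo q^N a theta series is a finite sum, and it may be rearranged along a
-- bijection of all of ℤ or ℤ[i], since only terms that vanish are gained or lost. Gauss' identity
-- becomes an exact polynomial identity whose error term is divisible by q^{n+1}. Letting N vary
-- gives the identities of full series, one coefficient at a time. The quotient by φ is never
-- formed: equations are multiplied out, and factors with constant term 1 are cancelled.

open import Defs
open import Algebra.Bundles using (CommutativeRing)
open import Algebra.Core using (Op₁; Op₂)
open import Algebra.Definitions
  using (Congruent₁; Congruent₂; Associative; Commutative; LeftIdentity; LeftInverse; _DistributesOverˡ_)
open import Data.Bool using (T; not)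
open import Data.Empty using (⊥; ⊥-elim)
open import Data.Fin using (Fin; toℕ; fromℕ<)
import Data.Fin as Fin
open import Data.Fin.Patterns using (0F; 1F; 2F; 3F; 4F; 5F; 6F; 7F)
import Data.Fin.Properties as Finₚ
open import Data.Integer using (ℤ; +_; -[1+_]; ∣_∣)
import Data.Integer as ℤ
import Data.Integer.DivMod as ℤ
import Data.Integer.Properties as ℤₚ
import Data.Integer.Solver as ℤ
import Algebra.Properties.AbelianGroup ℤₚ.+-0-abelianGroup as ℤ-group
open import Data.List using (List; []; _∷_; map; _++_; filter; cartesianProduct; allFin)
open import Data.List.Membership.Propositional using (_∈_)
open import Data.List.Membership.Propositional.Properties
  using (∈-map⁺; ∈-map⁻; ∈-filter⁺; ∈-filter⁻; ∈-cartesianProduct⁺; ∈-allFin)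
open import Data.List.Membership.Propositional.Properties.WithK using (unique∧set⇒bag)
open import Data.List.Relation.Binary.BagAndSetEquality using (∼bag⇒↭)
open import Data.List.Relation.Binary.Permutation.Propositional as Perm using (_↭_)
open import Data.List.Relation.Unary.All as All using (All)
open import Data.List.Relation.Unary.AllPairs using ([]; _∷_)
open import Data.List.Relation.Unary.Any using (here; there)
open import Data.List.Relation.Unary.Unique.Propositional using (Unique)
import Data.List.Relation.Unary.Unique.Propositional.Properties as Unique
open import Data.Maybe using (Maybe; just; nothing; is-just; to-witness-T)
open import Data.Nat
  using (ℕ; zero; suc; _+_; _*_; _∸_; _^_; _≤_; _<_; _%_; _≤?_; _<?_; _≟_; _≡ᵇ_; s≤s; z≤n)
import Data.Nat as ℕ
import Data.Nat.DivMod as ℕ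
import Data.Nat.Divisibility as ℕ
open import Data.Nat.DivMod using (%-distribˡ-+; %-distribˡ-*; [m+n]%n≡m%n; [m+kn]%n≡m%n; m*n%n≡0)
open import Data.Nat.Divisibility using (_∣_; _∣?_; m%n≡0⇒n∣m; ∣m+n∣m⇒∣n; >⇒∤; m∣m*n)
open import Data.Nat.GeneralisedArithmetic using (fold)
import Data.Nat.Properties as ℕₚ
import Data.Nat.Solver as ℕ
open import Data.Product using (_×_; _,_; ∃; proj₁; proj₂)
open import Data.Sum using (_⊎_; inj₁; inj₂)
open import Data.Unit using (⊤; tt)
open import Data.Vec using (Vec; []; _∷_; lookup)
open import Function using (_∘_)
open import Function.Bundles using (mk⇔)
open import Level using (0ℓ)
open import Relation.Binary.Bundles using (Setoid)
open import Relation.Binary.Core using (Rel)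
open import Relation.Binary.PropositionalEquality
  using (_≡_; _≢_; refl; sym; trans; cong; cong₂; subst; module ≡-Reasoning)
import Relation.Binary.Reasoning.Setoid as SetoidReasoning
open import Relation.Binary.Structures using (IsEquivalence)
open import Relation.Nullary using (¬_; Dec; yes; no; contradiction)
open import Relation.Nullary.Decidable using (_→-dec_; from-yes)

-- Power series

module _ {A : Set} {_≈_ : Rel A 0ℓ} {_⊕_ _⊗_ : Op₂ A} {⊖_ : Op₁ A} {𝟘 𝟙 : A}
  (isEquivalence : IsEquivalence _≈_)
  (⊕-cong : Congruent₂ _≈_ _⊕_) (⊕-assoc : Associative _≈_ _⊕_) (⊕-comm : Commutative _≈_ _⊕_)
  (⊕-identityˡ : LeftIdentity _≈_ 𝟘 _⊕_)
  (⊖-cong : Congruent₁ _≈_ ⊖_) (⊖-inverseˡ : LeftInverse _≈_ 𝟘 ⊖_ _⊕_)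
  (⊗-cong : Congruent₂ _≈_ _⊗_) (⊗-assoc : Associative _≈_ _⊗_) (⊗-comm : Commutative _≈_ _⊗_)
  (⊗-identityˡ : LeftIdentity _≈_ 𝟙 _⊗_)
  (⊗-distribˡ-⊕ : _DistributesOverˡ_ _≈_ _⊗_ _⊕_)
  where

  private
    setoid : Setoid 0ℓ 0ℓ
    setoid = record { isEquivalence = isEquivalence }

  open import Algebra.Consequences.Setoid setoid
    using (comm∧idˡ⇒id; comm∧invˡ⇒inv; comm∧distrˡ⇒distr)

  mkCommutativeRing : CommutativeRing 0ℓ 0ℓ
  mkCommutativeRing = record
    { Carrier = A ; _≈_ = _≈_ ; _+_ = _⊕_ ; _*_ = _⊗_ ; -_ = ⊖_ ; 0# = 𝟘 ; 1# = 𝟙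
    ; isCommutativeRing = record
      { isRing = record
        { +-isAbelianGroup = record
          { isGroup = record
            { isMonoid = record
              { isSemigroup = record
                { isMagma = record { isEquivalence = isEquivalence ; ∙-cong = ⊕-cong }
                ; assoc = ⊕-assoc }
              ; identity = comm∧idˡ⇒id ⊕-comm ⊕-identityˡ }
            ; inverse = comm∧invˡ⇒inv ⊕-comm ⊖-inverseˡ
            ; ⁻¹-cong = ⊖-cong }
          ; comm = ⊕-comm }
        ; *-cong = ⊗-cong
        ; *-assoc = ⊗-assoc
        ; *-identity = comm∧idˡ⇒id ⊗-comm ⊗-identityˡ
        ; distrib = comm∧distrˡ⇒distr ⊕-cong ⊗-comm ⊗-distribˡ-⊕ }
      ; *-comm = ⊗-comm } }

record _≈₅_ (m n : ℕ) : Set where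
  constructor mod5
  field rem≡ : m % 5 ≡ n % 5

open _≈₅_ public

≡⇒≈₅ : ∀ {m n} → m ≡ n → m ≈₅ n
≡⇒≈₅ = mod5 ∘ cong (_% 5)

-- The carrier is ℕ, so that counting functions are themselves series over this ring. Negation is
-- multiplication by 4, as x + 4x = 5x.
ℤ/5 : CommutativeRing 0ℓ 0ℓ
ℤ/5 = mkCommutativeRing {_≈_ = _≈₅_} {_⊕_ = _+_} {_⊗_ = _*_} {⊖_ = 4 *_} {𝟘 = 0} {𝟙 = 1}
  record { refl = mod5 refl ; sym = λ (mod5 p) → mod5 (sym p) ; trans = λ (mod5 p) (mod5 q) → mod5 (trans p q) }
  +-cong
  (λ x y z → ≡⇒≈₅ (ℕₚ.+-assoc x y z)) (λ x y → ≡⇒≈₅ (ℕₚ.+-comm x y)) (λ x → mod5 refl)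
  (λ {x} {y} → *-cong {4} {4} {x} {y} (mod5 refl))
  (λ x → mod5 (trans (cong (_% 5) (trans (ℕₚ.+-comm (4 * x) x) (ℕₚ.*-comm 5 x))) ([m+kn]%n≡m%n 0 x 5)))
  *-cong
  (λ x y z → ≡⇒≈₅ (ℕₚ.*-assoc x y z)) (λ x y → ≡⇒≈₅ (ℕₚ.*-comm x y)) (λ x → ≡⇒≈₅ (ℕₚ.*-identityˡ x))
  (λ x y z → ≡⇒≈₅ (ℕₚ.*-distribˡ-+ x y z))
  where
  +-cong : ∀ {x y u v} → x ≈₅ y → u ≈₅ v → (x + u) ≈₅ (y + v)
  +-cong {x} {y} {u} {v} (mod5 p) (mod5 q) = mod5 (trans (%-distribˡ-+ x u 5)
    (trans (cong₂ (λ a b → (a + b) % 5) p q) (sym (%-distribˡ-+ y v 5))))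
  *-cong : ∀ {x y u v} → x ≈₅ y → u ≈₅ v → (x * u) ≈₅ (y * v)
  *-cong {x} {y} {u} {v} (mod5 p) (mod5 q) = mod5 (trans (%-distribˡ-* x u 5)
    (trans (cong₂ (λ a b → (a * b) % 5) p q) (sym (%-distribˡ-* y v 5))))

-- Equality of the coefficients with index in a downset is compatible with products;
-- the downset below N gives power series modulo q^N.
record Downset : Set₁ where
  field
    _∋_  : ℕ → Set
    down : ∀ {m n} → m ≤ n → _∋_ n → _∋_ m

open Downset public

everything : Downset
everything = record { _∋_ = λ _ → ⊤ ; down = λ _ _ → tt }

below : ℕ → Downset
below N = record { _∋_ = _< N ; down = ℕₚ.≤-<-trans }

module PowerSeries (K : CommutativeRing 0ℓ 0ℓ) where

  private module K = CommutativeRing K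
  open K using () renaming (_+_ to _⊕_; _*_ to _⊗_; -_ to ⊖_; _≈_ to _≈ᴷ_)
  open import Algebra.Properties.CommutativeSemigroup K.+-commutativeSemigroup
    using (interchange)

  Series : Set
  Series = ℕ → K.Carrier

  tail : Series → Series
  tail f n = f (suc n)

  infixl 7 _⋆_ _•_
  infixl 6 _⊞_

  _⊞_ : Series → Series → Series
  (f ⊞ g) n = f n ⊕ g n

  _•_ : K.Carrier → Series → Series
  (c • f) n = c ⊗ f n

  -- The Cauchy product, read off from f = f 0 + q · `tail f`; later inductions on coefficients pass
  -- from f to `tail f` in the same way.
  _⋆_ : Series → Series → Series
  (f ⋆ g) zero    = f 0 ⊗ g 0
  (f ⋆ g) (suc n) = f 0 ⊗ g (suc n) ⊕ (tail f ⋆ g) n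

  neg : Series → Series
  neg f n = ⊖ f n

  𝟎 𝟏 : Series
  𝟎 _       = K.0#
  𝟏 zero    = K.1#
  𝟏 (suc _) = K.0#

  infix 4 _≈[_]_ _≈_

  record _≈[_]_ (f : Series) (D : Downset) (g : Series) : Set where
    constructor agree
    field at : ∀ n → D ∋ n → f n ≈ᴷ g n

  open _≈[_]_ public

  _≈_ : Series → Series → Set
  f ≈ g = f ≈[ everything ] g

  private
    module ⋆-laws where
      open SetoidReasoning K.setoid

      cong′ : ∀ {f f′ g g′} n → (∀ i → i ≤ n → f i ≈ᴷ f′ i) → (∀ i → i ≤ n → g i ≈ᴷ g′ i) →
              (f ⋆ g) n ≈ᴷ (f′ ⋆ g′) n
      cong′ zero    p q = K.*-cong (p 0 z≤n) (q 0 z≤n)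
      cong′ (suc n) p q = K.+-cong (K.*-cong (p 0 z≤n) (q (suc n) ℕₚ.≤-refl))
        (cong′ n (λ i i≤n → p (suc i) (s≤s i≤n)) (λ i i≤n → q i (ℕₚ.m≤n⇒m≤1+n i≤n)))

      -- The mirror image of the defining recursion, peeling the right factor; commutativity follows
      -- by playing the two against each other.
      tailʳ : ∀ f g n → (f ⋆ g) (suc n) ≈ᴷ (f ⋆ tail g) n ⊕ f (suc n) ⊗ g 0
      tailʳ f g zero    = K.refl
      tailʳ f g (suc n) = K.trans (K.+-congˡ (tailʳ (tail f) g n)) (K.sym (K.+-assoc _ _ _))

      comm : ∀ f g n → (f ⋆ g) n ≈ᴷ (g ⋆ f) n
      comm f g zero    = K.*-comm _ _
      comm f g (suc n) = begin
        f 0 ⊗ g (suc n) ⊕ (tail f ⋆ g) n  ≈⟨ K.+-cong (K.*-comm _ _) (comm (tail f) g n) ⟩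
        g (suc n) ⊗ f 0 ⊕ (g ⋆ tail f) n  ≈⟨ K.+-comm _ _ ⟩
        (g ⋆ tail f) n ⊕ g (suc n) ⊗ f 0  ≈⟨ tailʳ g f n ⟨
        (g ⋆ f) (suc n)                   ∎

      distribˡ : ∀ f g h n → (f ⋆ (g ⊞ h)) n ≈ᴷ (f ⋆ g) n ⊕ (f ⋆ h) n
      distribˡ f g h zero    = K.distribˡ _ _ _
      distribˡ f g h (suc n) =
        K.trans (K.+-cong (K.distribˡ _ _ _) (distribˡ (tail f) g h n)) (interchange _ _ _ _)

      distribʳ : ∀ f g h n → ((g ⊞ h) ⋆ f) n ≈ᴷ (g ⋆ f) n ⊕ (h ⋆ f) n
      distribʳ f g h n = K.trans (comm (g ⊞ h) f n)
        (K.trans (distribˡ f g h n) (K.+-cong (comm f g n) (comm f h n)))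

      scale : ∀ c f g n → ((c • f) ⋆ g) n ≈ᴷ c ⊗ (f ⋆ g) n
      scale c f g zero    = K.*-assoc _ _ _
      scale c f g (suc n) =
        K.trans (K.+-cong (K.*-assoc _ _ _) (scale c (tail f) g n)) (K.sym (K.distribˡ _ _ _))

      assoc : ∀ f g h n → ((f ⋆ g) ⋆ h) n ≈ᴷ (f ⋆ (g ⋆ h)) n
      assoc f g h zero    = K.*-assoc _ _ _
      assoc f g h (suc n) = begin
        (f 0 ⊗ g 0) ⊗ h (suc n) ⊕ ((f 0 • tail g ⊞ tail f ⋆ g) ⋆ h) n
          ≈⟨ K.+-cong (K.*-assoc _ _ _) (distribʳ h _ _ n) ⟩
        f 0 ⊗ (g 0 ⊗ h (suc n)) ⊕ (((f 0 • tail g) ⋆ h) n ⊕ ((tail f ⋆ g) ⋆ h) n)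
          ≈⟨ K.+-congˡ (K.+-cong (scale _ _ _ n) (assoc (tail f) g h n)) ⟩
        f 0 ⊗ (g 0 ⊗ h (suc n)) ⊕ (f 0 ⊗ (tail g ⋆ h) n ⊕ (tail f ⋆ (g ⋆ h)) n)
          ≈⟨ K.+-assoc _ _ _ ⟨
        (f 0 ⊗ (g 0 ⊗ h (suc n)) ⊕ f 0 ⊗ (tail g ⋆ h) n) ⊕ (tail f ⋆ (g ⋆ h)) n
          ≈⟨ K.+-congʳ (K.distribˡ _ _ _) ⟨
        f 0 ⊗ (g 0 ⊗ h (suc n) ⊕ (tail g ⋆ h) n) ⊕ (tail f ⋆ (g ⋆ h)) n ∎

      zeroˡ : ∀ f n → (𝟎 ⋆ f) n ≈ᴷ K.0#
      zeroˡ f zero    = K.zeroˡ _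
      zeroˡ f (suc n) = K.trans (K.+-cong (K.zeroˡ _) (zeroˡ f n)) (K.+-identityˡ _)

      identityˡ : ∀ f n → (𝟏 ⋆ f) n ≈ᴷ f n
      identityˡ f zero    = K.*-identityˡ _
      identityˡ f (suc n) =
        K.trans (K.+-cong (K.*-identityˡ _) (zeroˡ f n)) (K.+-identityʳ _)

  seriesRing : Downset → CommutativeRing 0ℓ 0ℓ
  seriesRing D = mkCommutativeRing {_≈_ = _≈[ D ]_} {_⊕_ = _⊞_} {_⊗_ = _⋆_} {⊖_ = neg} {𝟘 = 𝟎} {𝟙 = 𝟏}
    record { refl = agree λ _ _ → K.refl ; sym = λ p → agree λ n d → K.sym (at p n d)
           ; trans = λ p q → agree λ n d → K.trans (at p n d) (at q n d) }
    (λ p q → agree λ n d → K.+-cong (at p n d) (at q n d))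
    (λ f g h → agree λ n _ → K.+-assoc _ _ _)
    (λ f g → agree λ n _ → K.+-comm _ _)
    (λ f → agree λ n _ → K.+-identityˡ _)
    (λ p → agree λ n d → K.-‿cong (at p n d))
    (λ f → agree λ n _ → K.-‿inverseˡ _)
    (λ p q → agree λ n d → ⋆-laws.cong′ n (λ i i≤n → at p i (down D i≤n d)) (λ i i≤n → at q i (down D i≤n d)))
    (λ f g h → agree λ n _ → ⋆-laws.assoc f g h n)
    (λ f g → agree λ n _ → ⋆-laws.comm f g n)
    (λ f → agree λ n _ → ⋆-laws.identityˡ f n)
    (λ f g h → agree λ n _ → ⋆-laws.distribˡ f g h n)

-- Rings of characteristic 5

power : {A : Set} → Op₂ A → A → A → ℕ → A
power _⊗_ 𝟙 a zero    = 𝟙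
power _⊗_ 𝟙 a (suc k) = a ⊗ power _⊗_ 𝟙 a k

-- The instances are ℤ/5, the full series ring and its truncations, which share the Frobenius lemmas
-- and the solver.
record CharFiveRing : Set₁ where
  field commutativeRing : CommutativeRing 0ℓ 0ℓ
  open CommutativeRing commutativeRing public renaming (_+_ to _⊕_; _*_ to _⊗_)
  field 5≈0 : 1# ⊕ (1# ⊕ (1# ⊕ (1# ⊕ 1#))) ≈ 0#

module CharFive (R : CharFiveRing) where

  private module R = CharFiveRing R
  open CharFiveRing R using (Carrier; _≈_; 1#; 0#; _⊕_; _⊗_)
  open import Algebra.Properties.Semiring.Mult R.semiring using (×-homo-+; ×1-homo-*) renaming (_×_ to _·_)

  private
    open SetoidReasoning R.setoid

    5×k≈0 : ∀ k → (k * 5) · 1# ≈ 0#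
    5×k≈0 k = begin
      (k * 5) · 1#           ≈⟨ ×1-homo-* k 5 ⟩
      (k · 1#) ⊗ (5 · 1#)    ≈⟨ R.*-congˡ (R.trans (R.+-congˡ (R.+-congˡ (R.+-congˡ (R.+-congˡ (R.+-identityʳ 1#))))) R.5≈0) ⟩
      (k · 1#) ⊗ 0#          ≈⟨ R.zeroʳ _ ⟩
      0#                     ∎

    ×-mod : ∀ n → n · 1# ≈ (n % 5) · 1#
    ×-mod n = begin
      n · 1#                                       ≡⟨ cong (_· 1#) (ℕ.m≡m%n+[m/n]*n n 5) ⟩
      (n % 5 + n ℕ./ 5 * 5) · 1#                   ≈⟨ ×-homo-+ 1# (n % 5) (n ℕ./ 5 * 5) ⟩
      (n % 5) · 1# ⊕ (n ℕ./ 5 * 5) · 1#            ≈⟨ R.+-congˡ (5×k≈0 (n ℕ./ 5)) ⟩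
      (n % 5) · 1# ⊕ 0#                            ≈⟨ R.+-identityʳ _ ⟩
      (n % 5) · 1#                                 ∎

    coefficient≟ : ∀ m n → Maybe (m · 1# ≈ n · 1#)
    coefficient≟ m n with m % 5 ≟ n % 5
    ... | yes p = just (R.trans (×-mod m) (R.trans (R.reflexive (cong (_· 1#) p)) (R.sym (×-mod n))))
    ... | no _  = nothing

  module Solver where
    open import Algebra.Solver.Ring.NaturalCoefficients R.commutativeSemiring coefficient≟ public

    -- Unlike solve, this compares normal forms with coefficients taken modulo 5.
    solve₅ : ∀ {n} (ρ : Vec Carrier n) (e₁ e₂ : Polynomial n) →
             {T (is-just (normalise e₁ ≟N normalise e₂))} → ⟦ e₁ ⟧ ρ ≈ ⟦ e₂ ⟧ ρ
    solve₅ ρ e₁ e₂ {t} = prove ρ e₁ e₂ (⟦ to-witness-T (normalise e₁ ≟N normalise e₂) t ⟧N-cong ρ)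

  infix 9 4∙_ :4∙_

  fifth : Carrier → Carrier
  fifth x = x ⊗ (x ⊗ (x ⊗ (x ⊗ x)))

  open Solver

  :fifth : ∀ {n} → Polynomial n → Polynomial n
  :fifth x = x :* (x :* (x :* (x :* x)))

  -- The inner binomial coefficients 5, 10, 10, 5 vanish.
  fifth-+ : ∀ x y → fifth (x ⊕ y) ≈ fifth x ⊕ fifth y
  fifth-+ x y = solve₅ (x ∷ y ∷ []) (:fifth (X :+ Y)) (:fifth X :+ :fifth Y)
    where X = var 0F
          Y = var 1F

  fifth-* : ∀ x y → fifth (x ⊗ y) ≈ fifth x ⊗ fifth y
  fifth-* x y = solve₅ (x ∷ y ∷ []) (:fifth (X :* Y)) (:fifth X :* :fifth Y)
    where X = var 0F
          Y = var 1F

  fifth-1 : fifth 1# ≈ 1#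
  fifth-1 = solve₅ [] (:fifth (con 1)) (con 1)

  fifth-cong : ∀ {x y} → x ≈ y → fifth x ≈ fifth y
  fifth-cong p = R.*-cong p (R.*-cong p (R.*-cong p (R.*-cong p p)))

  -- This is negation, written so that the semiring solver applies.
  4∙_ : Carrier → Carrier
  4∙ x = (x ⊕ x) ⊕ (x ⊕ x)

  :4∙_ : ∀ {n} → Polynomial n → Polynomial n
  :4∙ x = (x :+ x) :+ (x :+ x)

  4∙-cong : ∀ {x y} → x ≈ y → 4∙ x ≈ 4∙ y
  4∙-cong p = R.+-cong (R.+-cong p p) (R.+-cong p p)

  frobenius : ℕ → Carrier → Carrier
  frobenius α a = fold a fifth α

  frobenius-cong : ∀ α {a b} → a ≈ b → frobenius α a ≈ frobenius α b
  frobenius-cong zero    p = p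
  frobenius-cong (suc α) p = fifth-cong (frobenius-cong α p)

  frobenius-1 : ∀ α → frobenius α 1# ≈ 1#
  frobenius-1 zero    = R.refl
  frobenius-1 (suc α) = R.trans (fifth-cong (frobenius-1 α)) fifth-1

  frobenius-* : ∀ α a b → frobenius α (a ⊗ b) ≈ frobenius α a ⊗ frobenius α b
  frobenius-* zero    a b = R.refl
  frobenius-* (suc α) a b = R.trans (fifth-cong (frobenius-* α a b)) (fifth-* _ _)

  infixr 8 _↑_

  _↑_ : Carrier → ℕ → Carrier
  _↑_ = power _⊗_ 1#

  ↑-+ : ∀ a m n → a ↑ (m + n) ≈ a ↑ m ⊗ a ↑ n
  ↑-+ a zero    n = R.sym (R.*-identityˡ _)
  ↑-+ a (suc m) n = R.trans (R.*-congˡ (↑-+ a m n)) (R.sym (R.*-assoc _ _ _))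

-- Dissection modulo 5

-- The formal properties of power series over ℤ/5: the grading by exponents modulo 5, and the
-- operator U keeping the exponents divisible by 5.
record SieveRing : Set₁ where
  field charFiveRing : CharFiveRing
  open CharFiveRing charFiveRing using (Carrier; _≈_; 1#; 0#; _⊕_; _⊗_)
  open CharFive charFiveRing using () renaming (fifth to F)
  field
    U          : Carrier → Carrier
    U-cong     : ∀ {f g} → f ≈ g → U f ≈ U g
    U-+        : ∀ f g → U (f ⊕ g) ≈ U f ⊕ U g
    U-1        : U 1# ≈ 1#
    U-F⊗       : ∀ f g → U (F f ⊗ g) ≈ f ⊗ U g
    Graded     : ℕ → Carrier → Set
    graded-≈₅  : ∀ {r s f} → r ≈₅ s → Graded r f → Graded s f
    graded-0   : ∀ {r} → Graded r 0#
    graded-1   : Graded 0 1#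
    graded-+   : ∀ {r f g} → Graded r f → Graded r g → Graded r (f ⊕ g)
    graded-*   : ∀ {r s f g} → Graded r f → Graded s g → Graded (r + s) (f ⊗ g)
    graded-F   : ∀ f → Graded 0 (F f)
    U-graded   : ∀ {r f} → Graded r f → ¬ 0 ≈₅ r → U f ≈ 0#

module Dissection (S : SieveRing) where

  open SieveRing S
  private module R = CharFiveRing charFiveRing
  open CharFiveRing charFiveRing using (Carrier; _≈_; 1#; 0#; _⊕_; _⊗_)
  open CharFive charFiveRing renaming (fifth to F)
  open Solver using (Polynomial; op; con; var; _:^_; :-_; [+]; [*]; ⟦_⟧; _:+_; _:*_; solve₅)

  module Homogeneity (A β γ : Carrier) (A-graded : Graded 0 A) (β-graded : Graded 1 β) (γ-graded : Graded 4 γ) where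

    ρ : Vec Carrier 3
    ρ = A ∷ β ∷ γ ∷ []

    -- Grades are computed from the syntax, so that the classes of long polynomials are checked by
    -- evaluation. A sum takes the grade of its left summand; `Homogeneous` checks that the right
    -- one agrees modulo 5.
    grade : Polynomial 3 → ℕ
    grade (op [+] p q) = grade p
    grade (op [*] p q) = grade p + grade q
    grade (con c)      = 0
    grade (var i)      = lookup (0 ∷ 1 ∷ 4 ∷ []) i
    -- A placeholder: `Homogeneous` rejects powers, so monomials are written as products.
    grade (p :^ n)     = 0
    grade (:- p)       = grade p

    Homogeneous : Polynomial 3 → Set
    Homogeneous (op [+] p q) = Homogeneous p × Homogeneous q × T (grade q % 5 ≡ᵇ grade p % 5)
    Homogeneous (op [*] p q) = Homogeneous p × Homogeneous q
    Homogeneous (con c)      = ⊤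
    Homogeneous (var i)      = ⊤
    Homogeneous (p :^ n)     = ⊥
    Homogeneous (:- p)       = Homogeneous p

    homogeneous⇒graded : ∀ p → Homogeneous p → Graded (grade p) (⟦ p ⟧ ρ)
    homogeneous⇒graded (op [+] p q) (hp , hq , eq) =
      graded-+ (homogeneous⇒graded p hp) (graded-≈₅ (mod5 (ℕₚ.≡ᵇ⇒≡ _ _ eq)) (homogeneous⇒graded q hq))
    homogeneous⇒graded (op [*] p q) (hp , hq) = graded-* (homogeneous⇒graded p hp) (homogeneous⇒graded q hq)
    homogeneous⇒graded (con c) _ = con-graded c
      where
      con-graded : ∀ c → Graded 0 (⟦ con c ⟧ ρ)
      con-graded zero          = graded-0
      con-graded (suc zero)    = graded-1
      con-graded (suc (suc c)) = graded-+ (con-graded (suc c)) graded-1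
    homogeneous⇒graded (var 0F) _ = A-graded
    homogeneous⇒graded (var 1F) _ = β-graded
    homogeneous⇒graded (var 2F) _ = γ-graded
    homogeneous⇒graded (:- p) h = homogeneous⇒graded p h

    NonzeroGrade : Polynomial 3 → Set
    NonzeroGrade p = T (not (0 ≡ᵇ grade p % 5))

    U-homogeneous : ∀ p → Homogeneous p → NonzeroGrade p → U (⟦ p ⟧ ρ) ≈ 0#
    U-homogeneous p h t = U-graded (homogeneous⇒graded p h) (nonzero (grade p % 5) t ∘ rem≡)
      where
      nonzero : ∀ k → T (not (0 ≡ᵇ k)) → ¬ 0 ≡ k
      nonzero zero    ()
      nonzero (suc k) _ ()

    -- `U` kills the four parts `r₁` to `r₄`, whose grades are nonzero. The side conditions evaluate
    -- to products of unit types and are filled in by unification.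
    U-dissect : ∀ p r₁ r₂ r₃ r₄ {f} → f ≈ ⟦ p :+ (r₁ :+ (r₂ :+ (r₃ :+ r₄))) ⟧ ρ →
      {_ : Homogeneous r₁ × Homogeneous r₂ × Homogeneous r₃ × Homogeneous r₄}
      {_ : NonzeroGrade r₁ × NonzeroGrade r₂ × NonzeroGrade r₃ × NonzeroGrade r₄} →
      U f ≈ U (⟦ p ⟧ ρ)
    U-dissect p r₁ r₂ r₃ r₄ eq {h₁ , h₂ , h₃ , h₄} {t₁ , t₂ , t₃ , t₄} =
      R.trans (U-cong eq) (R.trans (U-+ _ _) (R.trans (R.+-congˡ (kill r₁ h₁ t₁ (kill r₂ h₂ t₂ (kill r₃ h₃ t₃ (U-homogeneous r₄ h₄ t₄))))) (R.+-identityʳ _)))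
      where
      kill : ∀ r → Homogeneous r → NonzeroGrade r → ∀ {g} → U g ≈ 0# → U (⟦ r ⟧ ρ ⊕ g) ≈ 0#
      kill r h t g≈0 = R.trans (U-+ _ _) (R.trans (R.+-cong (U-homogeneous r h t) g≈0) (R.+-identityˡ _))

  U-F : ∀ f → U (F f) ≈ f
  U-F f = R.trans (U-cong (R.sym (R.*-identityʳ _))) (R.trans (U-F⊗ f 1#) (R.trans (R.*-congˡ U-1) (R.*-identityʳ f)))

  module Theta (φ β γ : Carrier)
    (φ≈ : φ ≈ F (F φ) ⊕ ((β ⊕ β) ⊕ (γ ⊕ γ)))
    (quadratic : F φ ⊗ F φ ≈ F (F φ) ⊗ F (F φ) ⊕ 4∙ (β ⊗ γ))
    (β-graded : Graded 1 β) (γ-graded : Graded 4 γ)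
    where

    private A = F (F φ)
    open Homogeneity A β γ (graded-F (F φ)) β-graded γ-graded
    open SetoidReasoning R.setoid

    private
      a b c Φ Q : Polynomial 3
      a = var 0F
      b = var 1F
      c = var 2F
      Φ = a :+ ((b :+ b) :+ (c :+ c))
      Q = a :* a :+ :4∙ (b :* c)

    φ² φ³ φ⁴ : Carrier
    φ² = φ ⊗ φ
    φ³ = φ ⊗ φ²
    φ⁴ = φ ⊗ φ³

    private
      φ²≈ : φ² ≈ ⟦ Φ :* Φ ⟧ ρ
      φ²≈ = R.*-cong φ≈ φ≈

      φ³≈ : φ³ ≈ ⟦ Φ :* (Φ :* Φ) ⟧ ρ
      φ³≈ = R.*-cong φ≈ φ²≈

      φ⁴≈ : φ⁴ ≈ ⟦ Φ :* (Φ :* (Φ :* Φ)) ⟧ ρ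
      φ⁴≈ = R.*-cong φ≈ φ³≈

      F-φ² : F φ² ≈ F φ ⊗ F φ
      F-φ² = fifth-* φ φ

      Q≈F-φ² : ⟦ Q ⟧ ρ ≈ F φ²
      Q≈F-φ² = R.trans (R.sym quadratic) (R.sym F-φ²)

    U-φ : U φ ≈ F φ
    -- φ has no exponents in the classes 2 and 3; `con 0 :* b` is an empty part whose syntactic
    -- grade is nonzero.
    U-φ = R.trans (U-dissect a (b :+ b) (con 0 :* b) (con 0 :* b) (c :+ c)
      (R.trans φ≈ (solve₅ ρ Φ (a :+ ((b :+ b) :+ (con 0 :* b :+ (con 0 :* b :+ (c :+ c)))))))) (U-F (F φ))

    -- The grade-0 part of (a + 2b + 2c)² is a² + 8bc = 2Q - a², where Q = a² + 4bc is F(φ²) and a²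
    -- is F(F(φ²)); both are fifth powers, which `U` undoes.
    U-φ² : U φ² ≈ (φ² ⊕ φ²) ⊕ 4∙ F φ²
    U-φ² = begin
      U φ²
        ≈⟨ U-dissect p r₁ r₂ r₃ r₄ (R.trans φ²≈ (solve₅ ρ (Φ :* Φ) (p :+ (r₁ :+ (r₂ :+ (r₃ :+ r₄)))))) ⟩
      U (⟦ p ⟧ ρ)
        ≈⟨ U-cong (R.+-cong (R.+-cong Q≈F-φ² Q≈F-φ²) (4∙-cong A²≈)) ⟩
      U ((F φ² ⊕ F φ²) ⊕ 4∙ F (F φ²))
        ≈⟨ U-cong (R.trans (fifth-+ _ _) (R.+-cong (fifth-+ _ _) (R.trans (fifth-+ _ _) (R.+-cong (fifth-+ _ _) (fifth-+ _ _))))) ⟨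
      U (F ((φ² ⊕ φ²) ⊕ 4∙ F φ²))
        ≈⟨ U-F _ ⟩
      (φ² ⊕ φ²) ⊕ 4∙ F φ² ∎
      where
      p r₁ r₂ r₃ r₄ : Polynomial 3
      p = (Q :+ Q) :+ :4∙ (a :* a)
      r₁ = con 4 :* a :* b
      r₂ = con 4 :* b :* b
      r₃ = con 4 :* c :* c
      r₄ = con 4 :* a :* c
      A²≈ : A ⊗ A ≈ F (F φ²)
      A²≈ = R.sym (R.trans (fifth-cong F-φ²) (fifth-* _ _))

    -- The grade-0 part of (a + 2b + 2c)³ is a³ + 24abc, which is aQ because 24 ≡ 4 (mod 5).
    U-φ³ : U φ³ ≈ F φ ⊗ φ²
    U-φ³ = begin
      U φ³
        ≈⟨ U-dissect p r₁ r₂ r₃ r₄ (R.trans φ³≈ (solve₅ ρ (Φ :* (Φ :* Φ)) (p :+ (r₁ :+ (r₂ :+ (r₃ :+ r₄)))))) ⟩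
      U (A ⊗ ⟦ Q ⟧ ρ)     ≈⟨ U-cong (R.*-congˡ Q≈F-φ²) ⟩
      U (A ⊗ F φ²)        ≈⟨ U-cong (fifth-* _ _) ⟨
      U (F (F φ ⊗ φ²))    ≈⟨ U-F _ ⟩
      F φ ⊗ φ²            ∎
      where
      p r₁ r₂ r₃ r₄ : Polynomial 3
      p = a :* Q
      r₁ = a :* a :* b :+ con 4 :* b :* b :* c
      r₂ = con 2 :* a :* b :* b :+ con 3 :* c :* c :* c
      r₃ = con 2 :* a :* c :* c :+ con 3 :* b :* b :* b
      r₄ = a :* a :* c :+ con 4 :* b :* c :* c

    -- The grade-0 part of (a + 2b + 2c)⁴ is a⁴ + 48a²bc + 96b²c², and modulo 5 this is Q² = a⁴ +
    -- 8a²bc + 16b²c².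
    U-φ⁴ : U φ⁴ ≈ φ⁴
    U-φ⁴ = begin
      U φ⁴
        ≈⟨ U-dissect p r₁ r₂ r₃ r₄ (R.trans φ⁴≈ (solve₅ ρ (Φ :* (Φ :* (Φ :* Φ))) (p :+ (r₁ :+ (r₂ :+ (r₃ :+ r₄)))))) ⟩
      U (⟦ Q :* Q ⟧ ρ)    ≈⟨ U-cong (R.*-cong Q≈F-φ² Q≈F-φ²) ⟩
      U (F φ² ⊗ F φ²)     ≈⟨ U-cong (fifth-* _ _) ⟨
      U (F (φ² ⊗ φ²))     ≈⟨ U-F _ ⟩
      φ² ⊗ φ²             ≈⟨ R.*-assoc _ _ _ ⟩
      φ⁴                  ∎
      where
      p r₁ r₂ r₃ r₄ : Polynomial 3
      p = Q :* Q
      r₁ = con 3 :* a :* a :* a :* b :+ a :* b :* b :* c :+ c :* c :* c :* c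
      r₂ = con 4 :* a :* a :* b :* b :+ con 2 :* a :* c :* c :* c :+ con 4 :* b :* b :* b :* c
      r₃ = con 4 :* a :* a :* c :* c :+ con 2 :* a :* b :* b :* b :+ con 4 :* b :* c :* c :* c
      r₄ = con 3 :* a :* a :* a :* c :+ a :* b :* c :* c :+ b :* b :* b :* b

    -- By `U-φ²` this is φ · U φ² = U (Fφ · φ²). Conversely U H = Fφ · φ², so H is fixed by two
    -- applications of `U`.
    H : Carrier
    H = φ ⊗ ((φ² ⊕ φ²) ⊕ 4∙ F φ²)

    -- U H = 2 U φ³ - φ² · U φ = 2 Fφ · φ² - φ² · Fφ.
    U-Fξ⊗H : ∀ ξ → U (F ξ ⊗ H) ≈ ξ ⊗ (F φ ⊗ φ²)
    U-Fξ⊗H ξ = R.trans (U-F⊗ ξ H) (R.*-congˡ (begin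
      U H ≈⟨ U-cong (solve₅ (φ ∷ F φ² ∷ []) (x :* ((x :* x :+ x :* x) :+ 4y)) ((x :* (x :* x) :+ x :* (x :* x)) :+ :4∙ (y :* x))) ⟩
      U ((φ³ ⊕ φ³) ⊕ 4∙ (F φ² ⊗ φ))
        ≈⟨ R.trans (U-+ _ _) (R.+-cong (U-+ _ _) (R.trans (U-+ _ _) (R.+-cong (U-+ _ _) (U-+ _ _)))) ⟩
      (U φ³ ⊕ U φ³) ⊕ 4∙ U (F φ² ⊗ φ)
        ≈⟨ R.+-cong (R.+-cong U-φ³ U-φ³) (4∙-cong e) ⟩
      (F φ ⊗ φ² ⊕ F φ ⊗ φ²) ⊕ 4∙ (φ² ⊗ F φ)
        ≈⟨ solve₅ (F φ ∷ φ² ∷ []) ((x :* y :+ x :* y) :+ :4∙ (y :* x)) (x :* y) ⟩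
      F φ ⊗ φ² ∎))
      where
      x y 4y : Polynomial 2
      x = var 0F
      y = var 1F
      4y = :4∙ y
      e : U (F φ² ⊗ φ) ≈ φ² ⊗ F φ
      e = R.trans (U-F⊗ φ² φ) (R.*-congˡ U-φ)

    U-ξ⊗Fφ⊗φ² : ∀ ξ → U (F ξ ⊗ (F φ ⊗ φ²)) ≈ ξ ⊗ H
    U-ξ⊗Fφ⊗φ² ξ = R.trans (U-F⊗ ξ _) (R.*-congˡ (R.trans (U-F⊗ φ φ²) (R.*-congˡ U-φ²)))

    record Dissected (f : Carrier) : Set where
      field
        h₀ h₂ h₃  : Carrier
        graded₀ : Graded 0 h₀
        graded₂ : Graded 2 h₂
        graded₃ : Graded 3 h₃
        sum≈    : f ≈ h₀ ⊕ (h₂ ⊕ h₃)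

    -- The parts of H in grades ±1 are 10 β (F φ)² and 10 γ (F φ)².
    H-dissected : ∀ ξ → Dissected (F ξ ⊗ H)
    H-dissected ξ = record
      { graded₀ = graded-* (graded-F ξ) (homogeneous⇒graded r₀ _)
      ; graded₂ = graded-* (graded-F ξ) (homogeneous⇒graded r₂ _)
      -- The grade 8 is read off the first summand of `r₃`, a multiple of a c².
      ; graded₃ = graded-≈₅ {8} {3} (mod5 refl) (graded-* (graded-F ξ) (homogeneous⇒graded r₃ _))
      ; sum≈ = begin
          F ξ ⊗ H
            ≈⟨ R.*-congˡ (R.*-cong φ≈ (R.+-cong (R.+-cong φ²≈ φ²≈) (4∙-cong e))) ⟩
          F ξ ⊗ ⟦ Φ :* ((Φ :* Φ :+ Φ :* Φ) :+ :4∙ Q) ⟧ ρ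
            ≈⟨ R.*-congˡ (solve₅ ρ (Φ :* ((Φ :* Φ :+ Φ :* Φ) :+ :4∙ Q)) (r₀ :+ (r₂ :+ r₃))) ⟩
          F ξ ⊗ (⟦ r₀ ⟧ ρ ⊕ (⟦ r₂ ⟧ ρ ⊕ ⟦ r₃ ⟧ ρ))
            ≈⟨ R.trans (R.distribˡ _ _ _) (R.+-congˡ (R.distribˡ _ _ _)) ⟩
          F ξ ⊗ ⟦ r₀ ⟧ ρ ⊕ (F ξ ⊗ ⟦ r₂ ⟧ ρ ⊕ F ξ ⊗ ⟦ r₃ ⟧ ρ) ∎
      }
      where
      r₀ r₂ r₃ : Polynomial 3
      r₀ = a :* a :* a :+ con 4 :* a :* b :* c
      r₂ = con 4 :* a :* b :* b :+ c :* c :* c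
      r₃ = con 4 :* a :* c :* c :+ b :* b :* b
      e = R.sym Q≈F-φ²

    U²ⁿ : ℕ → Carrier → Carrier
    U²ⁿ zero    f = f
    U²ⁿ (suc n) f = U²ⁿ n (U (U f))

    U²ⁿ-cong : ∀ n {f g} → f ≈ g → U²ⁿ n f ≈ U²ⁿ n g
    U²ⁿ-cong zero    p = p
    U²ⁿ-cong (suc n) p = U²ⁿ-cong n (U-cong (U-cong p))

    U²ⁿ-H : ∀ n m → U²ⁿ n (frobenius (n * 2 + m) φ ⊗ H) ≈ frobenius m φ ⊗ H
    U²ⁿ-H zero    m = R.refl
    U²ⁿ-H (suc n) m = R.trans (U²ⁿ-cong n (R.trans (U-cong (U-Fξ⊗H (F (frobenius (n * 2 + m) φ)))) (U-ξ⊗Fφ⊗φ² _))) (U²ⁿ-H n m)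

    module _ (φ-cancellable : ∀ {f g} → φ ⊗ f ≈ φ ⊗ g → f ≈ g) where

      -- Since 1/φ = φ⁴/F φ, applying U to a quotient by φ only requires U φ⁴.
      U-quotient : ∀ {G ψ} → φ ⊗ G ≈ F ψ → U G ≈ ψ ⊗ φ³
      U-quotient {G} {ψ} φG≈Fψ = φ-cancellable (begin
        φ ⊗ U G               ≈⟨ U-F⊗ φ G ⟨
        U (F φ ⊗ G)           ≈⟨ U-cong (R.trans (R.*-congʳ (R.*-comm φ φ⁴)) (R.*-assoc φ⁴ φ G)) ⟩
        U (φ⁴ ⊗ (φ ⊗ G))      ≈⟨ U-cong (R.trans (R.*-congˡ φG≈Fψ) (R.*-comm _ _)) ⟩
        U (F ψ ⊗ φ⁴)          ≈⟨ R.trans (U-F⊗ ψ φ⁴) (R.*-congˡ U-φ⁴) ⟩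
        ψ ⊗ (φ ⊗ φ³)          ≈⟨ R.trans (R.sym (R.*-assoc ψ φ φ³)) (R.trans (R.*-congʳ (R.*-comm ψ φ)) (R.*-assoc φ ψ φ³)) ⟩
        φ ⊗ (ψ ⊗ φ³)          ∎)

      U³-quotient : ∀ {G ξ} → φ ⊗ G ≈ F (F (F ξ)) → U (U (U G)) ≈ ξ ⊗ H
      U³-quotient {G} {ξ} φG≈ = begin
        U (U (U G))                   ≈⟨ U-cong (U-cong (U-quotient φG≈)) ⟩
        U (U (F (F ξ) ⊗ φ³))          ≈⟨ U-cong (R.trans (U-F⊗ (F ξ) φ³) (R.*-congˡ U-φ³)) ⟩
        U (F ξ ⊗ (F φ ⊗ φ²))          ≈⟨ U-ξ⊗Fφ⊗φ² ξ ⟩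
        ξ ⊗ H                         ∎

      -- In the exponent, 3 pays for U³, each further U² costs 2, and `suc m` keeps one F in front
      -- of H, as `H-dissected` requires.
      quotient-dissected : ∀ {G} n m → φ ⊗ G ≈ frobenius (3 + (n * 2 + suc m)) φ → Dissected (U²ⁿ n (U (U (U G))))
      quotient-dissected {G} n m φG≈ = record
        { Dissected dissected
        ; sum≈ = R.trans (U²ⁿ-cong n (U³-quotient φG≈)) (R.trans (U²ⁿ-H n (suc m)) (Dissected.sum≈ dissected)) }
        where dissected = H-dissected (frobenius m φ)

-- Gauss' identity

-- With u k = 1 + qᵏ, d k = 1 - qᵏ and S n = Σ_{|k| ≤ n} (-1)ᵏ q^{k²}, Shanks' finite form of
-- Gauss' identity reads
--   S n · Π_{k ≤ n} u k = Π_{k ≤ n} d k + 2 Σ_{s=1}^{n} (-1)ˢ (Π_{k < s} u k) (Π_{s < k ≤ n} d k) q^{s(n+1)}.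
module Gauss (R : CharFiveRing) (x : CharFiveRing.Carrier R) where

  private module R = CharFiveRing R
  open CharFiveRing R using (Carrier; _≈_; 1#; 0#; _⊕_; _⊗_)
  open CharFive R
  open Solver using (Polynomial; con; var; ⟦_⟧; _:+_; _:*_; solve₅)
  open SetoidReasoning R.setoid

  -x : Carrier
  -x = 4∙ x

  q u d Πu : ℕ → Carrier
  q = x ↑_
  u k = 1# ⊕ q k
  d k = 1# ⊕ 4∙ q k
  Πu zero    = 1#
  Πu (suc n) = Πu n ⊗ u (suc n)

  -- The product of `d i` over s < i ≤ s + k. It is peeled at its lower end because the summands of
  -- Shanks' identity share the upper end n while s moves.
  Πd : ℕ → ℕ → Carrier
  Πd s zero    = 1#
  Πd s (suc k) = d (suc s) ⊗ Πd (suc s) k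

  Πd-last : ∀ s k → Πd s (suc k) ≈ Πd s k ⊗ d (suc (s + k))
  Πd-last s zero    = R.trans (R.*-comm _ _) (R.*-congˡ (R.reflexive (cong (d ∘ suc) (sym (ℕₚ.+-identityʳ s)))))
  Πd-last s (suc k) = begin
    d (suc s) ⊗ Πd (suc s) (suc k)                       ≈⟨ R.*-congˡ (Πd-last (suc s) k) ⟩
    d (suc s) ⊗ (Πd (suc s) k ⊗ d (suc (suc s + k)))     ≈⟨ R.*-assoc _ _ _ ⟨
    Πd s (suc k) ⊗ d (suc (suc s + k))                   ≈⟨ R.*-congˡ (R.reflexive (cong (d ∘ suc) (ℕₚ.+-suc s k))) ⟨
    Πd s (suc k) ⊗ d (suc (s + suc k))                   ∎

  sgn : ℕ → Carrier
  sgn zero    = 1#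
  sgn (suc k) = 4∙ sgn k

  sgn-+ : ∀ m n → sgn (m + n) ≈ sgn m ⊗ sgn n
  sgn-+ zero    n = R.sym (R.*-identityˡ _)
  sgn-+ (suc m) n = R.trans (4∙-cong (sgn-+ m n))
    (solve₅ (sgn m ∷ sgn n ∷ []) (:4∙ (v :* w)) (:4∙ v :* w))
    where v = var 0F
          w = var 1F

  sgn² : ∀ n → sgn n ⊗ sgn n ≈ 1#
  sgn² zero    = R.*-identityˡ _
  sgn² (suc n) = R.trans (solve₅ (sgn n ∷ []) (:4∙ v :* :4∙ v) (v :* v)) (sgn² n)
    where v = var 0F

  -- n² and n have the same parity; hence the signs of the theta series can be absorbed into powers
  -- of `-x`.
  sgn-square : ∀ n → sgn (n * n) ≈ sgn n
  sgn-square zero    = R.refl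
  sgn-square (suc n) = begin
    sgn (suc n + n * suc n)               ≈⟨ sgn-+ (suc n) (n * suc n) ⟩
    sgn (suc n) ⊗ sgn (n * suc n)         ≈⟨ R.*-congˡ (R.reflexive (cong sgn (ℕₚ.*-suc n n))) ⟩
    sgn (suc n) ⊗ sgn (n + n * n)         ≈⟨ R.*-congˡ (R.trans (sgn-+ n (n * n)) (R.*-congˡ (sgn-square n))) ⟩
    sgn (suc n) ⊗ (sgn n ⊗ sgn n)         ≈⟨ R.trans (R.*-congˡ (sgn² n)) (R.*-identityʳ _) ⟩
    sgn (suc n)                           ∎

  ↑-neg : ∀ k → -x ↑ k ≈ sgn k ⊗ q k
  ↑-neg zero    = R.sym (R.*-identityˡ _)
  ↑-neg (suc k) = begin
    4∙ x ⊗ -x ↑ k             ≈⟨ R.*-congˡ (↑-neg k) ⟩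
    4∙ x ⊗ (sgn k ⊗ q k)        ≈⟨ solve₅ (x ∷ sgn k ∷ q k ∷ []) (:4∙ v :* (w :* z)) (:4∙ w :* (v :* z)) ⟩
    sgn (suc k) ⊗ q (suc k)     ∎
    where v = var 0F
          w = var 1F
          z = var 2F

  -- The part of the sum in Shanks' identity with r < s ≤ r + k, where n = r + k.
  rest : ℕ → ℕ → ℕ → Carrier
  rest n r zero    = 0#
  rest n r (suc k) = sgn (suc r) ⊗ (Πu r ⊗ (Πd (suc r) k ⊗ q (suc r * suc n))) ⊕ rest n (suc r) k

  -- A telescoping sum. Passing from m to m + 1 multiplies the summand of index s by qˢ (1 -
  -- q^{m+1}) instead of 1 + q^{m+1}, and the difference of these factors is -(1 - qˢ) - q^{m+1} (1
  -- + qˢ). The first part extends the product of `d` down to s, the second extends the product of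
  -- `u` up to s, and the second at s cancels the first at s + 1. Only the two end terms survive.
  rest-suc : ∀ m r k → m ≡ r + k →
    rest (suc m) r (suc k) ≈ (u (suc m) ⊗ rest m r k ⊕ sgn (suc m) ⊗ (q (suc m * suc m) ⊗ Πu (suc m)))
      ⊕ 4∙ (sgn (suc r) ⊗ (Πu r ⊗ (Πd r k ⊗ q (suc r * suc m))))
  rest-suc m r zero m≡r+0 with refl ← trans m≡r+0 (ℕₚ.+-identityʳ r) = begin
    rest (suc m) m 1
      ≈⟨ R.+-congʳ (R.*-congˡ (R.*-congˡ (R.*-congˡ (q-step m)))) ⟩
    s ⊗ (Πu m ⊗ (1# ⊗ (q (suc m) ⊗ q (suc m * suc m)))) ⊕ 0#
      ≈⟨ solve₅ (s ∷ Πu m ∷ q (suc m) ∷ q (suc m * suc m) ∷ [])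
           (S :* (P :* (con 1 :* (X :* Z))) :+ con 0)
           (((con 1 :+ X) :* con 0 :+ S :* (Z :* (P :* (con 1 :+ X)))) :+ :4∙ (S :* (P :* (con 1 :* Z)))) ⟩
    (u (suc m) ⊗ rest m m zero ⊕ s ⊗ (q (suc m * suc m) ⊗ Πu (suc m))) ⊕ 4∙ (s ⊗ (Πu m ⊗ (1# ⊗ q (suc m * suc m)))) ∎
    where
    s = sgn (suc m)
    S P X Z : Polynomial 4
    S = var 0F
    P = var 1F
    X = var 2F
    Z = var 3F
    q-step : ∀ m → q (suc m * suc (suc m)) ≈ q (suc m) ⊗ q (suc m * suc m)
    q-step m = R.trans (R.reflexive (cong q (ℕₚ.*-suc (suc m) (suc m)))) (↑-+ x (suc m) (suc m * suc m))
  rest-suc m r (suc k) m≡ = begin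
    s ⊗ (Πu r ⊗ (Πd (suc r) (suc k) ⊗ q (suc r * suc (suc m)))) ⊕ rest (suc m) (suc r) (suc k)
      ≈⟨ R.+-cong (R.*-congˡ (R.*-congˡ (R.*-cong Πd≈ q₁))) (rest-suc m (suc r) k m≡′) ⟩
    s ⊗ (Πu r ⊗ ((Πd (suc r) k ⊗ d (suc m)) ⊗ (q (suc r) ⊗ q₀))) ⊕ ((u (suc m) ⊗ R₀ ⊕ E) ⊕ 4∙ (4∙ s ⊗ ((Πu r ⊗ u (suc r)) ⊗ (Πd (suc r) k ⊗ q (suc (suc r) * suc m)))))
      ≈⟨ R.+-congˡ (R.+-congˡ (4∙-cong (R.*-congˡ (R.*-congˡ (R.*-congˡ (↑-+ x (suc m) (suc r * suc m))))))) ⟩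
    s ⊗ (Πu r ⊗ ((Πd (suc r) k ⊗ d (suc m)) ⊗ (q (suc r) ⊗ q₀))) ⊕ ((u (suc m) ⊗ R₀ ⊕ E) ⊕ 4∙ (4∙ s ⊗ ((Πu r ⊗ u (suc r)) ⊗ (Πd (suc r) k ⊗ (q (suc m) ⊗ q₀)))))
      ≈⟨ solve₅ (s ∷ Πu r ∷ Πd (suc r) k ∷ q (suc m) ∷ q (suc r) ∷ q₀ ∷ R₀ ∷ E ∷ [])
           (S :* (P :* ((D :* (con 1 :+ :4∙ M)) :* (Q :* Z))) :+ (((con 1 :+ M) :* L :+ W) :+ :4∙ (:4∙ S :* ((P :* (con 1 :+ Q)) :* (D :* (M :* Z))))))
           (((con 1 :+ M) :* (S :* (P :* (D :* Z)) :+ L) :+ W) :+ :4∙ (S :* (P :* (((con 1 :+ :4∙ Q) :* D) :* Z)))) ⟩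
    (u (suc m) ⊗ rest m r (suc k) ⊕ E) ⊕ 4∙ (s ⊗ (Πu r ⊗ (Πd r (suc k) ⊗ q₀))) ∎
    where
    s = sgn (suc r)
    q₀ = q (suc r * suc m)
    R₀ = rest m (suc r) k
    E = sgn (suc m) ⊗ (q (suc m * suc m) ⊗ Πu (suc m))
    m≡′ : m ≡ suc r + k
    m≡′ = trans m≡ (ℕₚ.+-suc r k)
    Πd≈ : Πd (suc r) (suc k) ≈ Πd (suc r) k ⊗ d (suc m)
    Πd≈ = R.trans (Πd-last (suc r) k) (R.*-congˡ (R.reflexive (cong (d ∘ suc) (sym m≡′))))
    q₁ : q (suc r * suc (suc m)) ≈ q (suc r) ⊗ q₀
    q₁ = R.trans (R.reflexive (cong q (ℕₚ.*-suc (suc r) (suc m)))) (↑-+ x (suc r) (suc r * suc m))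
    S P D M Q Z L W : Polynomial 8
    S = var 0F
    P = var 1F
    D = var 2F
    M = var 3F
    Q = var 4F
    Z = var 5F
    L = var 6F
    W = var 7F

  module _ (S : ℕ → Carrier) (S-zero : S 0 ≈ 1#)
    (S-suc : ∀ n → S (suc n) ≈ -x ↑ (suc n * suc n) ⊕ (-x ↑ (suc n * suc n) ⊕ S n))
    where

    -- By induction: the upper end term of `rest-suc` is the new term of S n, and twice the lower
    -- one supplies 2 q^{n+1} `Πd 0 n`, the difference between multiplying `Πd 0 n` by `u (suc n)`
    -- and by `d (suc n)`.
    shanks : ∀ n → S n ⊗ Πu n ≈ Πd 0 n ⊕ (rest n 0 n ⊕ rest n 0 n)
    shanks zero    = R.trans (R.*-congʳ S-zero) (solve₅ [] (con 1 :* con 1) (con 1 :+ (con 0 :+ con 0)))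
    shanks (suc n) = begin
      S (suc n) ⊗ Πu (suc n)
        ≈⟨ R.*-congʳ (R.trans (S-suc n) (R.+-cong y≈ (R.+-congʳ y≈))) ⟩
      (y ⊕ (y ⊕ S n)) ⊗ (Πu n ⊗ u (suc n))
        ≈⟨ solve₅ (y ∷ S n ∷ Πu n ∷ q (suc n) ∷ []) ((Y :+ (Y :+ L)) :* (P :* (con 1 :+ Q)))
             ((L :* P) :* (con 1 :+ Q) :+ (Y :* (P :* (con 1 :+ Q)) :+ Y :* (P :* (con 1 :+ Q)))) ⟩
      (S n ⊗ Πu n) ⊗ u (suc n) ⊕ (y ⊗ Πu (suc n) ⊕ y ⊗ Πu (suc n))
        ≈⟨ R.+-congʳ (R.*-congʳ (shanks n)) ⟩
      (Πd 0 n ⊕ (rest n 0 n ⊕ rest n 0 n)) ⊗ u (suc n) ⊕ (y ⊗ Πu (suc n) ⊕ y ⊗ Πu (suc n))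
        ≈⟨ solve₅ (Πd 0 n ∷ rest n 0 n ∷ q (suc n) ∷ q (suc n * suc n) ∷ sgn (suc n) ∷ Πu (suc n) ∷ [])
             ((D :+ (V :+ V)) :* (con 1 :+ N) :+ ((s :* z) :* p :+ (s :* z) :* p))
             (D :* (con 1 :+ :4∙ N) :+ (v :+ v)) ⟩
      Πd 0 n ⊗ d (suc n) ⊕ (r ⊕ r)
        ≈⟨ R.+-cong (R.sym (Πd-last 0 n)) (R.+-cong r≈ r≈) ⟩
      Πd 0 (suc n) ⊕ (rest (suc n) 0 (suc n) ⊕ rest (suc n) 0 (suc n)) ∎
      where
      y = sgn (suc n) ⊗ q (suc n * suc n)
      y≈ : -x ↑ (suc n * suc n) ≈ y
      y≈ = R.trans (↑-neg (suc n * suc n)) (R.*-congʳ (sgn-square (suc n)))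
      r = (u (suc n) ⊗ rest n 0 n ⊕ sgn (suc n) ⊗ (q (suc n * suc n) ⊗ Πu (suc n)))
            ⊕ 4∙ (sgn 1 ⊗ (1# ⊗ (Πd 0 n ⊗ q (suc n))))
      r≈ : r ≈ rest (suc n) 0 (suc n)
      r≈ = R.trans (R.+-congˡ (4∙-cong (R.*-congˡ (R.*-congˡ (R.*-congˡ
             (R.reflexive (cong q (sym (ℕₚ.*-identityˡ (suc n))))))))))
             (R.sym (rest-suc n 0 n refl))
      Y L P Q : Polynomial 4
      Y = var 0F
      L = var 1F
      P = var 2F
      Q = var 3F
      D V N z s p v : Polynomial 6
      D = var 0F
      V = var 1F
      N = var 2F
      z = var 3F
      s = var 4F
      p = var 5F
      v = ((con 1 :+ N) :* V :+ s :* (z :* p)) :+ :4∙ (:4∙ (con 1) :* (con 1 :* (D :* N)))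

    -- Every summand of `rest n 0 n` contains a power of q^{n+1}.
    gauss : ∀ n → q (suc n) ≈ 0# → S n ⊗ Πu n ≈ Πd 0 n
    gauss n q≈0 = R.trans (shanks n) (R.trans (R.+-congˡ (R.trans (R.+-cong (rest≈0 0 n) (rest≈0 0 n)) (R.+-identityˡ _)))
      (R.+-identityʳ _))
      where
      q-multiple : ∀ r → q (suc r * suc n) ≈ 0#
      q-multiple r = R.trans (↑-+ x (suc n) (r * suc n)) (R.trans (R.*-congʳ q≈0) (R.zeroˡ _))

      rest≈0 : ∀ r k → rest n r k ≈ 0#
      rest≈0 r zero    = R.refl
      rest≈0 r (suc k) = R.trans (R.+-cong (R.trans (R.*-congˡ (R.trans (R.*-congˡ
        (R.trans (R.*-congˡ (q-multiple r)) (R.zeroʳ _))) (R.zeroʳ _))) (R.zeroʳ _)) (rest≈0 (suc r) k))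
        (R.+-identityˡ _)

-- Sums of powers over finite lists

sumOver : {A I : Set} → Op₂ A → A → List I → (I → A) → A
sumOver _⊕_ 𝟘 []       f = 𝟘
sumOver _⊕_ 𝟘 (i ∷ is) f = f i ⊕ sumOver _⊕_ 𝟘 is f

module Sums (R : CharFiveRing) where

  private module R = CharFiveRing R
  open CharFiveRing R using (Carrier; _≈_; 1#; 0#; _⊕_; _⊗_)
  open CharFive R
  open SetoidReasoning R.setoid

  ∑ : {I : Set} → List I → (I → Carrier) → Carrier
  ∑ = sumOver _⊕_ 0#

  private variable I J : Set

  ∑-cong : {f g : I → Carrier} → (∀ i → f i ≈ g i) → ∀ L → ∑ L f ≈ ∑ L g
  ∑-cong p []      = R.refl
  ∑-cong p (i ∷ L) = R.+-cong (p i) (∑-cong p L)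

  ∑-↭ : ∀ {L M : List I} (f : I → Carrier) → L ↭ M → ∑ L f ≈ ∑ M f
  ∑-↭ f Perm.refl          = R.refl
  ∑-↭ f (Perm.prep x p)    = R.+-congˡ (∑-↭ f p)
  ∑-↭ f (Perm.swap x y p)  = R.trans (R.sym (R.+-assoc _ _ _))
    (R.trans (R.+-cong (R.+-comm _ _) (∑-↭ f p)) (R.+-assoc _ _ _))
  ∑-↭ f (Perm.trans p q)   = R.trans (∑-↭ f p) (∑-↭ f q)

  ∑-++ : ∀ (L M : List I) f → ∑ (L ++ M) f ≈ ∑ L f ⊕ ∑ M f
  ∑-++ []      M f = R.sym (R.+-identityˡ _)
  ∑-++ (i ∷ L) M f = R.trans (R.+-congˡ (∑-++ L M f)) (R.sym (R.+-assoc _ _ _))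

  ∑-map : ∀ (g : J → I) f L → ∑ (map g L) f ≡ ∑ L (f ∘ g)
  ∑-map g f []      = refl
  ∑-map g f (j ∷ L) = cong (f (g j) ⊕_) (∑-map g f L)

  ∑-cartesianProduct : ∀ (L : List I) (M : List J) f →
    ∑ (cartesianProduct L M) f ≈ ∑ L (λ i → ∑ M λ j → f (i , j))
  ∑-cartesianProduct []      M f = R.refl
  ∑-cartesianProduct (i ∷ L) M f = R.trans (∑-++ (map (i ,_) M) _ f)
    (R.+-cong (R.reflexive (∑-map (i ,_) f M)) (∑-cartesianProduct L M f))

  ∑-*ˡ : ∀ a (L : List I) f → ∑ L (λ i → a ⊗ f i) ≈ a ⊗ ∑ L f
  ∑-*ˡ a []      f = R.sym (R.zeroʳ a)
  ∑-*ˡ a (i ∷ L) f = R.trans (R.+-congˡ (∑-*ˡ a L f)) (R.sym (R.distribˡ _ _ _))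

  ∑-*ʳ : ∀ a (L : List I) f → ∑ L (λ i → f i ⊗ a) ≈ ∑ L f ⊗ a
  ∑-*ʳ a []      f = R.sym (R.zeroˡ a)
  ∑-*ʳ a (i ∷ L) f = R.trans (R.+-congˡ (∑-*ʳ a L f)) (R.sym (R.distribʳ _ _ _))

  ∑-⊗ : ∀ (L : List I) (M : List J) f g →
    ∑ (cartesianProduct L M) (λ (i , j) → f i ⊗ g j) ≈ ∑ L f ⊗ ∑ M g
  ∑-⊗ L M f g = R.trans (∑-cartesianProduct L M _)
    (R.trans (∑-cong (λ i → ∑-*ˡ (f i) M g) L) (∑-*ʳ (∑ M g) L f))

  ∑-filter : {P : I → Set} (P? : ∀ i → Dec (P i)) → ∀ f → (∀ i → ¬ P i → f i ≈ 0#) →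
    ∀ L → ∑ L f ≈ ∑ (filter P? L) f
  ∑-filter P? f f≈0 []      = R.refl
  ∑-filter P? f f≈0 (i ∷ L) with P? i
  ... | yes _  = R.+-congˡ (∑-filter P? f f≈0 L)
  ... | no ¬Pi = R.trans (R.+-cong (f≈0 i ¬Pi) (∑-filter P? f f≈0 L)) (R.+-identityˡ _)

  fifth-0 : fifth 0# ≈ 0#
  fifth-0 = R.zeroˡ _

  fifth-∑ : ∀ (L : List I) f → fifth (∑ L f) ≈ ∑ L (fifth ∘ f)
  fifth-∑ []      f = fifth-0
  fifth-∑ (i ∷ L) f = R.trans (fifth-+ _ _) (R.+-congˡ (fifth-∑ L f))

  fifth-↑ : ∀ a k → fifth (a ↑ k) ≈ a ↑ (5 * k)
  fifth-↑ a k = R.sym (R.trans (↑-+ a k _) (R.*-congˡ (R.trans (↑-+ a k _) (R.*-congˡ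
    (R.trans (↑-+ a k _) (R.*-congˡ (R.trans (↑-+ a k _) (R.*-congˡ
    (R.reflexive (cong (a ↑_) (ℕₚ.+-identityʳ k)))))))))))

  module Nilpotent (y : Carrier) (N : ℕ) (y↑N≈0 : y ↑ N ≈ 0#) where

    ↑-vanishes : ∀ {k} → N ≤ k → y ↑ k ≈ 0#
    ↑-vanishes {k} N≤k with o , refl ← ℕₚ.m≤n⇒∃[o]m+o≡n N≤k =
      R.trans (↑-+ y N o) (R.trans (R.*-congʳ y↑N≈0) (R.zeroˡ _))

    -- The bijection g is between whole index types, but the lists are finite. It suffices that each
    -- list contains every index of weight below N: after discarding the vanishing terms, the two
    -- lists are permutations of each other.
    ∑-reindex : (w : I → ℕ) (g : J → I) → (∀ {j k} → g j ≡ g k → j ≡ k) → (∀ i → ∃ λ j → g j ≡ i) →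
      ∀ {L M} → Unique L → Unique M → (∀ i → w i < N → i ∈ L) → (∀ j → w (g j) < N → j ∈ M) →
      ∑ L (λ i → y ↑ w i) ≈ ∑ M (λ j → y ↑ w (g j))
    ∑-reindex {I = I} w g g-injective g-surjective {L} {M} L! M! ∈L ∈M = begin
      ∑ L (λ i → y ↑ w i)                                     ≈⟨ ∑-filter w<? _ (λ i → ↑-vanishes ∘ ℕₚ.≮⇒≥) L ⟩
      ∑ (filter w<? L) (λ i → y ↑ w i)                        ≈⟨ ∑-↭ _ L↭M ⟩
      ∑ (map g (filter (w<? ∘ g) M)) (λ i → y ↑ w i)          ≡⟨ ∑-map g _ (filter (w<? ∘ g) M) ⟩
      ∑ (filter (w<? ∘ g) M) (λ j → y ↑ w (g j))              ≈⟨ ∑-filter (w<? ∘ g) _ (λ j → ↑-vanishes ∘ ℕₚ.≮⇒≥) M ⟨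
      ∑ M (λ j → y ↑ w (g j))                                 ∎
      where
      w<? = λ i → w i <? N
      to : ∀ {i} → i ∈ filter w<? L → i ∈ map g (filter (w<? ∘ g) M)
      to {i} i∈ with j , refl ← g-surjective i | i∈L , wi<N ← ∈-filter⁻ w<? {xs = L} i∈ =
        ∈-map⁺ g (∈-filter⁺ (w<? ∘ g) (∈M j wi<N) wi<N)
      from : ∀ {i} → i ∈ map g (filter (w<? ∘ g) M) → i ∈ filter w<? L
      from i∈ with j , j∈ , refl ← ∈-map⁻ g i∈ with _ , wj<N ← ∈-filter⁻ (w<? ∘ g) {xs = M} j∈ =
        ∈-filter⁺ w<? (∈L (g j) wj<N) wj<N
      L↭M : filter w<? L ↭ map g (filter (w<? ∘ g) M)
      L↭M = ∼bag⇒↭ (unique∧set⇒bag (Unique.filter⁺ w<? L!) (Unique.map⁺ g-injective (Unique.filter⁺ (w<? ∘ g) M!)) (mk⇔ to from))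

-- Squares and norms modulo 5

-- Grown by the pair ±(n + 1), so that theta sums over boxes satisfy the recurrence assumed for S in
-- Gauss' identity by definition.
box : ℕ → List ℤ
box zero    = + 0 ∷ []
box (suc n) = + suc n ∷ -[1+ n ] ∷ box n

∈box⇒≤ : ∀ {k} n → k ∈ box n → ∣ k ∣ ℕ.≤ n
∈box⇒≤ zero    (here refl)          = z≤n
∈box⇒≤ (suc n) (here refl)          = ℕₚ.≤-refl
∈box⇒≤ (suc n) (there (here refl))  = ℕₚ.≤-refl
∈box⇒≤ (suc n) (there (there k∈))   = ℕₚ.m≤n⇒m≤1+n (∈box⇒≤ n k∈)

≤⇒∈box : ∀ k n → ∣ k ∣ ℕ.≤ n → k ∈ box n
≤⇒∈box (+ zero) zero    z≤n = here refl
≤⇒∈box k        (suc n) k≤  with ℕₚ.m≤n⇒m<n∨m≡n k≤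
... | inj₁ (s≤s k≤n) = there (there (≤⇒∈box k n k≤n))
≤⇒∈box (+ _)    (suc n) _ | inj₂ refl = here refl
≤⇒∈box -[1+ _ ] (suc n) _ | inj₂ refl = there (here refl)

box-unique : ∀ n → Unique (box n)
box-unique zero    = All.[] ∷ []
box-unique (suc n) = ((λ ()) All.∷ outside ℕₚ.≤-refl) ∷ (outside ℕₚ.≤-refl ∷ box-unique n)
  where
  outside : ∀ {k} → n ℕ.< ∣ k ∣ → All (k ≢_) (box n)
  outside n<k = All.tabulate λ { k∈ refl → ℕₚ.<⇒≱ n<k (∈box⇒≤ n k∈) }

sq : ℤ → ℕ
sq k = ∣ k ∣ ℕ.* ∣ k ∣

+sq : ∀ k → + sq k ≡ k ℤ.* k
+sq (+ n)    = ℤₚ.pos-* n n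
+sq -[1+ n ] = refl

∣k∣≤sq : ∀ k → ∣ k ∣ ℕ.≤ sq k
∣k∣≤sq k with ∣ k ∣
... | zero  = z≤n
... | suc n = ℕₚ.m≤m*n (suc n) (suc n)

infix 7 5×_⊹_

5×_⊹_ : ℤ → ℤ → ℤ
5× k ⊹ c = c ℤ.+ k ℤ.* + 5

-- If t = |5k + c| were below |k|, then 5|k| ≤ t + 2 < 5(t + 1) ≤ 5|k|. The bound keeps the
-- quotients k inside the same box as 5k + c.
∣k∣≤∣5k+c∣ : ∀ c k → ∣ c ∣ ℕ.≤ 2 → ∣ k ∣ ℕ.≤ ∣ 5× k ⊹ c ∣
∣k∣≤∣5k+c∣ c k c≤2 = ℕₚ.≮⇒≥ λ t<k → ℕₚ.<-irrefl refl (begin-strict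
  ∣ k ∣ ℕ.* 5                       ≡⟨ ℤₚ.abs-* k (+ 5) ⟨
  ∣ k ℤ.* + 5 ∣                     ≡⟨ cong ∣_∣ (solve 2 (λ c k → k := (c :+ k) :+ :- c) refl c (k ℤ.* + 5)) ⟩
  ∣ (5× k ⊹ c) ℤ.+ ℤ.- c ∣          ≤⟨ ℤₚ.∣i+j∣≤∣i∣+∣j∣ (5× k ⊹ c) (ℤ.- c) ⟩
  ∣ 5× k ⊹ c ∣ ℕ.+ ∣ ℤ.- c ∣        ≤⟨ ℕₚ.+-monoʳ-≤ ∣ 5× k ⊹ c ∣ (ℕₚ.≤-trans (ℕₚ.≤-reflexive (ℤₚ.∣-i∣≡∣i∣ c)) c≤2) ⟩
  ∣ 5× k ⊹ c ∣ ℕ.+ 2                <⟨ ℕₚ.+-monoʳ-< ∣ 5× k ⊹ c ∣ (s≤s (s≤s (s≤s z≤n))) ⟩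
  ∣ 5× k ⊹ c ∣ ℕ.+ 5                ≤⟨ ℕₚ.+-monoˡ-≤ 5 (ℕₚ.m≤m*n ∣ 5× k ⊹ c ∣ 5) ⟩
  ∣ 5× k ⊹ c ∣ ℕ.* 5 ℕ.+ 5          ≡⟨ ℕₚ.+-comm _ 5 ⟩
  suc ∣ 5× k ⊹ c ∣ ℕ.* 5            ≤⟨ ℕₚ.*-monoˡ-≤ 5 t<k ⟩
  ∣ k ∣ ℕ.* 5                       ∎)
  where
  open ℕₚ.≤-Reasoning
  open ℤ.+-*-Solver

residue-unique : ∀ (r s : Fin 5) p q → 5× p ⊹ (+ toℕ r) ≡ 5× q ⊹ (+ toℕ s) → r ≡ s × p ≡ q
residue-unique r s p q eq =
  r≡s , ℤₚ.*-cancelʳ-≡ p q (+ 5) (ℤ-group.∙-cancelˡ (+ toℕ r) _ _ (trans eq (cong (λ s → 5× q ⊹ (+ toℕ s)) (sym r≡s))))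
  where
  open ℤ.+-*-Solver
  small? : Dec (∀ (r s : Fin 5) → 5 ℕ.∣ ∣ toℕ r ℤ.⊖ toℕ s ∣ → r ≡ s)
  small? = Finₚ.all? λ r → Finₚ.all? λ s → (5 ℕ.∣? ∣ toℕ r ℤ.⊖ toℕ s ∣) →-dec (r Finₚ.≟ s)

  small : ∀ (r s : Fin 5) → 5 ℕ.∣ ∣ toℕ r ℤ.⊖ toℕ s ∣ → r ≡ s
  small = from-yes small?

  difference : toℕ r ℤ.⊖ toℕ s ≡ (q ℤ.- p) ℤ.* + 5
  difference = begin
    toℕ r ℤ.⊖ toℕ s                 ≡⟨ ℤₚ.m-n≡m⊖n (toℕ r) (toℕ s) ⟨
    + toℕ r ℤ.- + toℕ s           ≡⟨ solve 4 (λ p q r s → r :- s := ((r :+ p :* con (+ 5)) :- s) :- p :* con (+ 5)) refl p q (+ toℕ r) (+ toℕ s) ⟩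
    (5× p ⊹ (+ toℕ r) ℤ.- + toℕ s) ℤ.- p ℤ.* + 5
                                  ≡⟨ cong (λ t → (t ℤ.- + toℕ s) ℤ.- p ℤ.* + 5) eq ⟩
    (5× q ⊹ (+ toℕ s) ℤ.- + toℕ s) ℤ.- p ℤ.* + 5
                                  ≡⟨ solve 3 (λ p q s → ((s :+ q :* con (+ 5)) :- s) :- p :* con (+ 5) := (q :- p) :* con (+ 5)) refl p q (+ toℕ s) ⟩
    (q ℤ.- p) ℤ.* + 5             ∎
    where open ≡-Reasoning

  r≡s : r ≡ s
  r≡s = small r s (ℕ.divides ∣ q ℤ.- p ∣ (trans (cong ∣_∣ difference) (ℤₚ.abs-* (q ℤ.- p) (+ 5))))

residue : ∀ t → ∃ λ (r : Fin 5) → ∃ λ q → t ≡ 5× q ⊹ (+ toℕ r)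
residue t = fromℕ< (ℤ.n%ℕd<d t 5) , t ℤ./ℕ 5 ,
  trans (ℤ.a≡a%ℕn+[a/ℕn]*n t 5) (cong (λ r → 5× t ℤ./ℕ 5 ⊹ (+ r)) (sym (Finₚ.toℕ-fromℕ< (ℤ.n%ℕd<d t 5))))

-- The classes 3 and 4 are taken as the negatives of 2 and 1; squares then agree in pairs, whence
-- the coefficients 2 of β and γ.
fromResidue : Fin 5 × ℤ → ℤ
fromResidue (0F , k) = 5× k ⊹ + 0
fromResidue (1F , k) = 5× k ⊹ + 1
fromResidue (2F , k) = 5× k ⊹ + 2
fromResidue (3F , k) = ℤ.- (5× k ⊹ + 2)
fromResidue (4F , k) = ℤ.- (5× k ⊹ + 1)

quotient : Fin 5 → ℤ → ℤ
quotient 0F k = k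
quotient 1F k = k
quotient 2F k = k
quotient 3F k = ℤ.- k ℤ.- + 1
quotient 4F k = ℤ.- k ℤ.- + 1

quotient-involutive : ∀ r k → quotient r (quotient r k) ≡ k
quotient-involutive 0F k = refl
quotient-involutive 1F k = refl
quotient-involutive 2F k = refl
quotient-involutive 3F k = solve 1 (λ k → :- (:- k :- con (+ 1)) :- con (+ 1) := k) refl k where open ℤ.+-*-Solver
quotient-involutive 4F k = solve 1 (λ k → :- (:- k :- con (+ 1)) :- con (+ 1) := k) refl k where open ℤ.+-*-Solver

fromResidue≡ : ∀ r k → fromResidue (r , k) ≡ 5× quotient r k ⊹ (+ toℕ r)
fromResidue≡ 0F k = refl
fromResidue≡ 1F k = refl
fromResidue≡ 2F k = refl
fromResidue≡ 3F k = solve 1 (λ k → :- (con (+ 2) :+ k :* con (+ 5)) := con (+ 3) :+ (:- k :- con (+ 1)) :* con (+ 5)) refl k where open ℤ.+-*-Solver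
fromResidue≡ 4F k = solve 1 (λ k → :- (con (+ 1) :+ k :* con (+ 5)) := con (+ 4) :+ (:- k :- con (+ 1)) :* con (+ 5)) refl k where open ℤ.+-*-Solver

fromResidue-injective : ∀ {i j} → fromResidue i ≡ fromResidue j → i ≡ j
fromResidue-injective {r , k} {s , l} eq
  with refl , qk≡ql ← residue-unique r s (quotient r k) (quotient s l) (trans (sym (fromResidue≡ r k)) (trans eq (fromResidue≡ s l)))
  = cong {B = Fin 5 × ℤ} (r ,_) (trans (sym (quotient-involutive r k)) (trans (cong (quotient r) qk≡ql) (quotient-involutive r l)))

fromResidue-surjective : ∀ t → ∃ λ i → fromResidue i ≡ t
fromResidue-surjective t with r , q , t≡ ← residue t =
  (r , quotient r q) , trans (fromResidue≡ r (quotient r q)) (trans (cong (λ k → 5× k ⊹ (+ toℕ r)) (quotient-involutive r q)) (sym t≡))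

-- Multiplication by 2 + i maps ℤ[i] onto the numbers z = x + i y with residue x + 3 y ≡ 0 (mod 5);
-- the other classes modulo 2 + i are represented by the units 1, i, -1, -i, with residues
-- 1, 3, 4, 2.  The point with coordinates (u , v) is (2 + i)(u - i v) in class 0 and
-- ε (1 + (2 + i)(u - i v)) in the class of the unit ε.
fromGaussianResidue : Fin 5 × (ℤ × ℤ) → ℤ × ℤ
fromGaussianResidue (0F , u , v) = + 2 ℤ.* u ℤ.+ v                , u ℤ.- + 2 ℤ.* v
fromGaussianResidue (1F , u , v) = + 2 ℤ.* u ℤ.+ v ℤ.+ + 1        , u ℤ.- + 2 ℤ.* v
fromGaussianResidue (2F , u , v) = u ℤ.- + 2 ℤ.* v                , ℤ.- (+ 2 ℤ.* u ℤ.+ v ℤ.+ + 1)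
fromGaussianResidue (3F , u , v) = ℤ.- (u ℤ.- + 2 ℤ.* v)          , + 2 ℤ.* u ℤ.+ v ℤ.+ + 1
fromGaussianResidue (4F , u , v) = ℤ.- (+ 2 ℤ.* u ℤ.+ v ℤ.+ + 1)  , ℤ.- (u ℤ.- + 2 ℤ.* v)

-- Reduction modulo 2 + i, under which i becomes -2 ≡ 3.
gaussianResidue : ℤ × ℤ → ℤ
gaussianResidue (x , y) = x ℤ.+ + 3 ℤ.* y

gaussianQuotient : Fin 5 → ℤ × ℤ → ℤ
gaussianQuotient 0F (u , v) = u ℤ.- v
gaussianQuotient 1F (u , v) = u ℤ.- v
gaussianQuotient 2F (u , v) = ℤ.- u ℤ.- v ℤ.- + 1
gaussianQuotient 3F (u , v) = u ℤ.+ v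
gaussianQuotient 4F (u , v) = v ℤ.- u ℤ.- + 1

-- Solves for (u , v), given the quotient q and the second coordinate y. The linear system has
-- determinant -1 in every class, so the solution is integral.
gaussianCoordinates : Fin 5 → ℤ → ℤ → ℤ × ℤ
gaussianCoordinates 0F q y = + 2 ℤ.* q ℤ.- y          , q ℤ.- y
gaussianCoordinates 1F q y = + 2 ℤ.* q ℤ.- y          , q ℤ.- y
gaussianCoordinates 2F q y = q ℤ.- y                  , y ℤ.- + 2 ℤ.* q ℤ.- + 1
gaussianCoordinates 3F q y = y ℤ.- + 1 ℤ.- q          , + 2 ℤ.* q ℤ.- y ℤ.+ + 1
gaussianCoordinates 4F q y = y ℤ.- + 2 ℤ.* q ℤ.- + 2  , y ℤ.- q ℤ.- + 1

module _ where
  open ℤ.+-*-Solver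

  gaussianResidue≡ : ∀ r w → gaussianResidue (fromGaussianResidue (r , w)) ≡ 5× gaussianQuotient r w ⊹ (+ toℕ r)
  gaussianResidue≡ 0F (u , v) = solve 2 (λ u v → con (+ 2) :* u :+ v :+ con (+ 3) :* (u :- con (+ 2) :* v) := con (+ 0) :+ (u :- v) :* con (+ 5)) refl u v
  gaussianResidue≡ 1F (u , v) = solve 2 (λ u v → con (+ 2) :* u :+ v :+ con (+ 1) :+ con (+ 3) :* (u :- con (+ 2) :* v) := con (+ 1) :+ (u :- v) :* con (+ 5)) refl u v
  gaussianResidue≡ 2F (u , v) = solve 2 (λ u v → u :- con (+ 2) :* v :+ con (+ 3) :* (:- (con (+ 2) :* u :+ v :+ con (+ 1))) := con (+ 2) :+ (:- u :- v :- con (+ 1)) :* con (+ 5)) refl u v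
  gaussianResidue≡ 3F (u , v) = solve 2 (λ u v → :- (u :- con (+ 2) :* v) :+ con (+ 3) :* (con (+ 2) :* u :+ v :+ con (+ 1)) := con (+ 3) :+ (u :+ v) :* con (+ 5)) refl u v
  gaussianResidue≡ 4F (u , v) = solve 2 (λ u v → :- (con (+ 2) :* u :+ v :+ con (+ 1)) :+ con (+ 3) :* (:- (u :- con (+ 2) :* v)) := con (+ 4) :+ (v :- u :- con (+ 1)) :* con (+ 5)) refl u v

  gaussianCoordinates-left : ∀ r w → gaussianCoordinates r (gaussianQuotient r w) (proj₂ (fromGaussianResidue (r , w))) ≡ w
  gaussianCoordinates-left 0F (u , v) = cong₂ _,_
    (solve 2 (λ u v → con (+ 2) :* (u :- v) :- (u :- con (+ 2) :* v) := u) refl u v)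
    (solve 2 (λ u v → (u :- v) :- (u :- con (+ 2) :* v) := v) refl u v)
  gaussianCoordinates-left 1F (u , v) = cong₂ _,_
    (solve 2 (λ u v → con (+ 2) :* (u :- v) :- (u :- con (+ 2) :* v) := u) refl u v)
    (solve 2 (λ u v → (u :- v) :- (u :- con (+ 2) :* v) := v) refl u v)
  gaussianCoordinates-left 2F (u , v) = cong₂ _,_
    (solve 2 (λ u v → (:- u :- v :- con (+ 1)) :- :- (con (+ 2) :* u :+ v :+ con (+ 1)) := u) refl u v)
    (solve 2 (λ u v → :- (con (+ 2) :* u :+ v :+ con (+ 1)) :- con (+ 2) :* (:- u :- v :- con (+ 1)) :- con (+ 1) := v) refl u v)
  gaussianCoordinates-left 3F (u , v) = cong₂ _,_
    (solve 2 (λ u v → con (+ 2) :* u :+ v :+ con (+ 1) :- con (+ 1) :- (u :+ v) := u) refl u v)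
    (solve 2 (λ u v → con (+ 2) :* (u :+ v) :- (con (+ 2) :* u :+ v :+ con (+ 1)) :+ con (+ 1) := v) refl u v)
  gaussianCoordinates-left 4F (u , v) = cong₂ _,_
    (solve 2 (λ u v → :- (u :- con (+ 2) :* v) :- con (+ 2) :* (v :- u :- con (+ 1)) :- con (+ 2) := u) refl u v)
    (solve 2 (λ u v → :- (u :- con (+ 2) :* v) :- (v :- u :- con (+ 1)) :- con (+ 1) := v) refl u v)

  gaussianCoordinates-right : ∀ r q y →
    fromGaussianResidue (r , gaussianCoordinates r q y) ≡ (5× q ⊹ (+ toℕ r) ℤ.- + 3 ℤ.* y , y)
  gaussianCoordinates-right 0F q y = cong₂ _,_
    (solve 2 (λ q y → con (+ 2) :* (con (+ 2) :* q :- y) :+ (q :- y) := con (+ 0) :+ q :* con (+ 5) :- con (+ 3) :* y) refl q y)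
    (solve 2 (λ q y → (con (+ 2) :* q :- y) :- con (+ 2) :* (q :- y) := y) refl q y)
  gaussianCoordinates-right 1F q y = cong₂ _,_
    (solve 2 (λ q y → con (+ 2) :* (con (+ 2) :* q :- y) :+ (q :- y) :+ con (+ 1) := con (+ 1) :+ q :* con (+ 5) :- con (+ 3) :* y) refl q y)
    (solve 2 (λ q y → (con (+ 2) :* q :- y) :- con (+ 2) :* (q :- y) := y) refl q y)
  gaussianCoordinates-right 2F q y = cong₂ _,_
    (solve 2 (λ q y → (q :- y) :- con (+ 2) :* (y :- con (+ 2) :* q :- con (+ 1)) := con (+ 2) :+ q :* con (+ 5) :- con (+ 3) :* y) refl q y)
    (solve 2 (λ q y → :- (con (+ 2) :* (q :- y) :+ (y :- con (+ 2) :* q :- con (+ 1)) :+ con (+ 1)) := y) refl q y)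
  gaussianCoordinates-right 3F q y = cong₂ _,_
    (solve 2 (λ q y → :- ((y :- con (+ 1) :- q) :- con (+ 2) :* (con (+ 2) :* q :- y :+ con (+ 1))) := con (+ 3) :+ q :* con (+ 5) :- con (+ 3) :* y) refl q y)
    (solve 2 (λ q y → con (+ 2) :* (y :- con (+ 1) :- q) :+ (con (+ 2) :* q :- y :+ con (+ 1)) :+ con (+ 1) := y) refl q y)
  gaussianCoordinates-right 4F q y = cong₂ _,_
    (solve 2 (λ q y → :- (con (+ 2) :* (y :- con (+ 2) :* q :- con (+ 2)) :+ (y :- q :- con (+ 1)) :+ con (+ 1)) := con (+ 4) :+ q :* con (+ 5) :- con (+ 3) :* y) refl q y)
    (solve 2 (λ q y → :- ((y :- con (+ 2) :* q :- con (+ 2)) :- con (+ 2) :* (y :- q :- con (+ 1))) := y) refl q y)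

fromGaussianResidue-injective : ∀ {i j} → fromGaussianResidue i ≡ fromGaussianResidue j → i ≡ j
fromGaussianResidue-injective {r , w} {s , z} eq
  with refl , qw≡qz ← residue-unique r s (gaussianQuotient r w) (gaussianQuotient s z) (trans (sym (gaussianResidue≡ r w)) (trans (cong gaussianResidue eq) (gaussianResidue≡ s z)))
  = cong (r ,_) (trans (sym (gaussianCoordinates-left r w))
      (trans (cong₂ (gaussianCoordinates r) qw≡qz (cong proj₂ eq)) (gaussianCoordinates-left r z)))

fromGaussianResidue-surjective : ∀ z → ∃ λ i → fromGaussianResidue i ≡ z
fromGaussianResidue-surjective (x , y) with r , q , t≡ ← residue (gaussianResidue (x , y)) =
  (r , gaussianCoordinates r q y) , trans (gaussianCoordinates-right r q y) (cong (_, y) (begin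
    5× q ⊹ (+ toℕ r) ℤ.- + 3 ℤ.* y           ≡⟨ cong (ℤ._- + 3 ℤ.* y) t≡ ⟨
    (x ℤ.+ + 3 ℤ.* y) ℤ.- + 3 ℤ.* y          ≡⟨ solve 2 (λ x y → (x :+ con (+ 3) :* y) :- con (+ 3) :* y := x) refl x y ⟩
    x ∎))
  where
  open ≡-Reasoning
  open ℤ.+-*-Solver

norm : ℤ × ℤ → ℕ
norm (x , y) = sq x ℕ.+ sq y

+5norm : ∀ x y → + (5 ℕ.* norm (x , y)) ≡ + 5 ℤ.* (x ℤ.* x ℤ.+ y ℤ.* y)
+5norm x y = trans (ℤₚ.pos-* 5 (norm (x , y))) (cong ((+ 5) ℤ.*_) (cong₂ ℤ._+_ (+sq x) (+sq y)))

-- 5 |z|² = |(2 - i) z|², and (2 - i)(2 + i)(u - i v) = 5u - 5v i.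
5norm-0 : ∀ u v → 5 ℕ.* norm (fromGaussianResidue (0F , u , v)) ≡ sq (5× u ⊹ + 0) ℕ.+ sq (5× v ⊹ + 0)
5norm-0 u v = ℤₚ.+-injective (trans (+5norm (+ 2 ℤ.* u ℤ.+ v) (u ℤ.- + 2 ℤ.* v)) (trans
  (solve 2 (λ u v → let x = con (+ 2) :* u :+ v ; y = u :- con (+ 2) :* v
                        z = con (+ 0) :+ u :* con (+ 5) ; w = con (+ 0) :+ v :* con (+ 5) in
     con (+ 5) :* (x :* x :+ y :* y) := z :* z :+ w :* w) refl u v)
  (sym (cong₂ ℤ._+_ (+sq (5× u ⊹ + 0)) (+sq (5× v ⊹ + 0))))))
  where open ℤ.+-*-Solver

-- Here (2 - i)(1 + (2 + i)(u - i v)) = (5u + 2) - (5v + 1) i. Using u - i v rather than u + i v is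
-- what makes the second offset +1.
5norm-1 : ∀ u v → 5 ℕ.* norm (fromGaussianResidue (1F , u , v)) ≡ sq (5× u ⊹ + 2) ℕ.+ sq (5× v ⊹ + 1)
5norm-1 u v = ℤₚ.+-injective (trans (+5norm (+ 2 ℤ.* u ℤ.+ v ℤ.+ + 1) (u ℤ.- + 2 ℤ.* v)) (trans
  (solve 2 (λ u v → let x = con (+ 2) :* u :+ v :+ con (+ 1) ; y = u :- con (+ 2) :* v
                        z = con (+ 2) :+ u :* con (+ 5) ; w = con (+ 1) :+ v :* con (+ 5) in
     con (+ 5) :* (x :* x :+ y :* y) := z :* z :+ w :* w) refl u v)
  (sym (cong₂ ℤ._+_ (+sq (5× u ⊹ + 2)) (+sq (5× v ⊹ + 1))))))
  where open ℤ.+-*-Solver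

sq-neg : ∀ k → sq (ℤ.- k) ≡ sq k
sq-neg k = cong₂ ℕ._*_ (ℤₚ.∣-i∣≡∣i∣ k) (ℤₚ.∣-i∣≡∣i∣ k)

norm-swap : ∀ x y → norm (x , y) ≡ norm (y , x)
norm-swap x y = ℕₚ.+-comm (sq x) (sq y)

-- The unit classes differ by a rotation through a multiple of 90 degrees, which preserves the norm.
5norm-unit : ∀ r u v → 5 ℕ.* norm (fromGaussianResidue (Fin.suc r , u , v)) ≡ sq (5× u ⊹ + 2) ℕ.+ sq (5× v ⊹ + 1)
5norm-unit r u v = trans (cong (5 ℕ.*_) (rotate r)) (5norm-1 u v)
  where
  x = + 2 ℤ.* u ℤ.+ v ℤ.+ + 1
  y = u ℤ.- + 2 ℤ.* v
  rotate : ∀ r → norm (fromGaussianResidue (Fin.suc r , u , v)) ≡ norm (x , y)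
  rotate 0F = refl
  rotate 1F = trans (cong (sq y ℕ.+_) (sq-neg x)) (norm-swap y x)
  rotate 2F = trans (cong (ℕ._+ sq x) (sq-neg y)) (norm-swap y x)
  rotate 3F = cong₂ ℕ._+_ (sq-neg x) (sq-neg y)

-- Theta series

sq-5k : ∀ k → sq (5× k ⊹ + 0) ≡ 5 * (5 * sq k)
sq-5k k = trans (cong₂ _*_ ∣5k∣ ∣5k∣) (solve 1 (λ n → (n :* con 5) :* (n :* con 5) := con 5 :* (con 5 :* (n :* n))) refl ∣ k ∣)
  where
  open ℕ.+-*-Solver
  ∣5k∣ : ∣ 5× k ⊹ + 0 ∣ ≡ ∣ k ∣ * 5
  ∣5k∣ = trans (cong ∣_∣ (ℤₚ.+-identityˡ (k ℤ.* + 5))) (ℤₚ.abs-* k (+ 5))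

offset : Fin 5 → ℤ
offset 0F = + 0
offset 1F = + 1
offset 2F = + 2
offset 3F = + 2
offset 4F = + 1

∣offset∣≤2 : ∀ r → ∣ offset r ∣ ≤ 2
∣offset∣≤2 0F = z≤n
∣offset∣≤2 1F = s≤s z≤n
∣offset∣≤2 2F = ℕₚ.≤-refl
∣offset∣≤2 3F = ℕₚ.≤-refl
∣offset∣≤2 4F = s≤s z≤n

sq-fromResidue : ∀ r k → sq (fromResidue (r , k)) ≡ sq (5× k ⊹ offset r)
sq-fromResidue 0F k = refl
sq-fromResidue 1F k = refl
sq-fromResidue 2F k = refl
sq-fromResidue 3F k = sq-neg (5× k ⊹ + 2)
sq-fromResidue 4F k = sq-neg (5× k ⊹ + 1)

∣k∣≤sq-5k+c : ∀ c k → ∣ c ∣ ≤ 2 → ∣ k ∣ ≤ sq (5× k ⊹ c)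
∣k∣≤sq-5k+c c k c≤2 = ℕₚ.≤-trans (∣k∣≤∣5k+c∣ c k c≤2) (∣k∣≤sq (5× k ⊹ c))

module ThetaIdentities (R : CharFiveRing) (y : CharFiveRing.Carrier R)
  (N : ℕ) (y↑N≈0 : CharFiveRing._≈_ R (CharFive._↑_ R y N) (CharFiveRing.0# R)) where

  private module R = CharFiveRing R
  open CharFiveRing R using (Carrier; _≈_; 1#; 0#; _⊕_; _⊗_)
  open CharFive R
  open Sums R
  open Nilpotent y N y↑N≈0
  open SetoidReasoning R.setoid

  φ : Carrier
  φ = ∑ (box N) (λ k → y ↑ sq k)

  θ : ℤ → Carrier
  θ c = ∑ (box N) (λ k → y ↑ sq (5× k ⊹ c))

  private
    ↑-≡ : ∀ {m n} → m ≡ n → y ↑ m ≈ y ↑ n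
    ↑-≡ = R.reflexive ∘ cong (y ↑_)

    ∈-box : ∀ c k {m} → ∣ c ∣ ≤ 2 → sq (5× k ⊹ c) ≤ m → m < N → k ∈ box N
    ∈-box c k c≤2 ≤m m<N = ≤⇒∈box k N (ℕₚ.≤-trans (∣k∣≤sq-5k+c c k c≤2) (ℕₚ.≤-trans ≤m (ℕₚ.<⇒≤ m<N)))

  fifth-φ : fifth φ ≈ ∑ (box N) (λ k → y ↑ (5 * sq k))
  fifth-φ = R.trans (fifth-∑ (box N) _) (∑-cong (λ k → fifth-↑ y (sq k)) (box N))

  θ-0 : fifth (fifth φ) ≈ θ (+ 0)
  θ-0 = begin
    fifth (fifth φ)                              ≈⟨ fifth-cong fifth-φ ⟩
    fifth (∑ (box N) (λ k → y ↑ (5 * sq k)))     ≈⟨ fifth-∑ (box N) _ ⟩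
    ∑ (box N) (λ k → fifth (y ↑ (5 * sq k)))     ≈⟨ ∑-cong (λ k → R.trans (fifth-↑ y (5 * sq k)) (↑-≡ (sym (sq-5k k)))) (box N) ⟩
    θ (+ 0)                                      ∎

  φ-dissection : φ ≈ fifth (fifth φ) ⊕ ((θ (+ 1) ⊕ θ (+ 1)) ⊕ (θ (+ 2) ⊕ θ (+ 2)))
  φ-dissection = begin
    φ
      ≈⟨ ∑-reindex sq fromResidue fromResidue-injective fromResidue-surjective (box-unique N)
           (Unique.cartesianProduct⁺ (Unique.allFin⁺ 5) (box-unique N))
           (λ k sq<N → ≤⇒∈box k N (ℕₚ.≤-trans (∣k∣≤sq k) (ℕₚ.<⇒≤ sq<N)))
           (λ (r , k) sq<N → ∈-cartesianProduct⁺ (∈-allFin r)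
             (∈-box (offset r) k (∣offset∣≤2 r) (ℕₚ.≤-reflexive (sym (sq-fromResidue r k))) sq<N)) ⟩
    ∑ (cartesianProduct (allFin 5) (box N)) (λ i → y ↑ sq (fromResidue i))
      ≈⟨ ∑-cartesianProduct (allFin 5) (box N) _ ⟩
    ∑ (allFin 5) (λ r → ∑ (box N) (λ k → y ↑ sq (fromResidue (r , k))))
      ≈⟨ ∑-cong (λ r → ∑-cong (λ k → ↑-≡ (sq-fromResidue r k)) (box N)) (allFin 5) ⟩
    ∑ (allFin 5) (λ r → θ (offset r))
      ≈⟨ Solver.solve₅ (θ (+ 0) ∷ θ (+ 1) ∷ θ (+ 2) ∷ [])
           (a :+ (b :+ (c :+ (c :+ (b :+ con 0))))) (a :+ ((b :+ b) :+ (c :+ c))) ⟩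
    θ (+ 0) ⊕ ((θ (+ 1) ⊕ θ (+ 1)) ⊕ (θ (+ 2) ⊕ θ (+ 2)))
      ≈⟨ R.+-congʳ θ-0 ⟨
    fifth (fifth φ) ⊕ ((θ (+ 1) ⊕ θ (+ 1)) ⊕ (θ (+ 2) ⊕ θ (+ 2))) ∎
    where
    open Solver using (Polynomial; con; var; _:+_)
    a b c : Polynomial 3
    a = var 0F
    b = var 1F
    c = var 2F

  fifth-φ² : fifth φ ⊗ fifth φ ≈ fifth (fifth φ) ⊗ fifth (fifth φ) ⊕ 4∙ (θ (+ 1) ⊗ θ (+ 2))
  fifth-φ² = begin
    fifth φ ⊗ fifth φ
      ≈⟨ R.*-cong fifth-φ fifth-φ ⟩
    ∑ (box N) (λ k → y ↑ (5 * sq k)) ⊗ ∑ (box N) (λ k → y ↑ (5 * sq k))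
      ≈⟨ ∑-⊗ (box N) (box N) _ _ ⟨
    ∑ box² (λ (a , b) → y ↑ (5 * sq a) ⊗ y ↑ (5 * sq b))
      ≈⟨ ∑-cong (λ (a , b) → R.trans (R.sym (↑-+ y (5 * sq a) (5 * sq b))) (↑-≡ (sym (ℕₚ.*-distribˡ-+ 5 (sq a) (sq b))))) box² ⟩
    ∑ box² (λ z → y ↑ (5 * norm z))
      ≈⟨ ∑-reindex (λ z → 5 * norm z) fromGaussianResidue fromGaussianResidue-injective fromGaussianResidue-surjective
           box²-unique (Unique.cartesianProduct⁺ (Unique.allFin⁺ 5) box²-unique) complete complete′ ⟩
    ∑ (cartesianProduct (allFin 5) box²) (λ i → y ↑ (5 * norm (fromGaussianResidue i)))
      ≈⟨ ∑-cartesianProduct (allFin 5) box² _ ⟩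
    ∑ (allFin 5) (λ r → ∑ box² (λ w → y ↑ (5 * norm (fromGaussianResidue (r , w)))))
      ≈⟨ ∑-cong class (allFin 5) ⟩
    ∑ (allFin 5) (λ r → θ (proj₁ (offsets r)) ⊗ θ (proj₂ (offsets r)))
      -- In `4∙` the 4 counts the unit classes, each of which contributes the same product.
      ≈⟨ Solver.solve₅ (θ (+ 0) ∷ θ (+ 1) ∷ θ (+ 2) ∷ [])
           (a :* a :+ (c :* b :+ (c :* b :+ (c :* b :+ (c :* b :+ con 0))))) (a :* a :+ :4∙ (b :* c)) ⟩
    θ (+ 0) ⊗ θ (+ 0) ⊕ 4∙ (θ (+ 1) ⊗ θ (+ 2))
      ≈⟨ R.+-congʳ (R.*-cong θ-0 θ-0) ⟨
    fifth (fifth φ) ⊗ fifth (fifth φ) ⊕ 4∙ (θ (+ 1) ⊗ θ (+ 2)) ∎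
    where
    open Solver using (Polynomial; con; var; _:+_; _:*_)
    a b c : Polynomial 3
    a = var 0F
    b = var 1F
    c = var 2F

    box² = cartesianProduct (box N) (box N)
    box²-unique = Unique.cartesianProduct⁺ (box-unique N) (box-unique N)

    offsets : Fin 5 → ℤ × ℤ
    offsets 0F          = + 0 , + 0
    offsets (Fin.suc r) = + 2 , + 1

    5norm≡ : ∀ r u v → 5 * norm (fromGaussianResidue (r , u , v)) ≡
      sq (5× u ⊹ proj₁ (offsets r)) + sq (5× v ⊹ proj₂ (offsets r))
    5norm≡ 0F          u v = 5norm-0 u v
    5norm≡ (Fin.suc r) u v = 5norm-unit r u v

    offsets≤2 : ∀ r → ∣ proj₁ (offsets r) ∣ ≤ 2 × ∣ proj₂ (offsets r) ∣ ≤ 2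
    offsets≤2 0F          = z≤n , z≤n
    offsets≤2 (Fin.suc r) = ℕₚ.≤-refl , s≤s z≤n

    class : ∀ r → ∑ box² (λ w → y ↑ (5 * norm (fromGaussianResidue (r , w)))) ≈
      θ (proj₁ (offsets r)) ⊗ θ (proj₂ (offsets r))
    class r = R.trans
      (∑-cong (λ (u , v) → R.trans (↑-≡ (5norm≡ r u v)) (↑-+ y (sq (5× u ⊹ proj₁ (offsets r))) _)) box²)
      (∑-⊗ (box N) (box N) _ _)

    complete : ∀ z → 5 * norm z < N → z ∈ box²
    complete (a , b) 5n<N = ∈-cartesianProduct⁺ (in-box a (ℕₚ.m≤m+n (sq a) (sq b))) (in-box b (ℕₚ.m≤n+m (sq b) (sq a)))
      where
      in-box : ∀ k → sq k ≤ norm (a , b) → k ∈ box N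
      in-box k ≤norm = ≤⇒∈box k N (ℕₚ.≤-trans (∣k∣≤sq k) (ℕₚ.≤-trans ≤norm
        (ℕₚ.≤-trans (ℕₚ.m≤n*m (norm (a , b)) 5) (ℕₚ.<⇒≤ 5n<N))))

    complete′ : ∀ i → 5 * norm (fromGaussianResidue i) < N → i ∈ cartesianProduct (allFin 5) box²
    complete′ (r , u , v) 5n<N = ∈-cartesianProduct⁺ (∈-allFin r) (∈-cartesianProduct⁺
      (∈-box (proj₁ (offsets r)) u (proj₁ (offsets≤2 r)) (ℕₚ.m≤m+n _ _) 5n<N′)
      (∈-box (proj₂ (offsets r)) v (proj₂ (offsets≤2 r)) (ℕₚ.m≤n+m _ _) 5n<N′))
      where 5n<N′ = subst (_< N) (5norm≡ r u v) 5n<N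

-- Products for overpartitions

module OverpartitionProducts (R : CharFiveRing) (x : CharFiveRing.Carrier R) where

  private module R = CharFiveRing R
  open CharFiveRing R using (Carrier; _≈_; 1#; 0#; _⊕_; _⊗_)
  open CharFive R
  open Solver using (Polynomial; con; var; _:+_; _:*_; solve₅)
  open Gauss R x
  open SetoidReasoning R.setoid

  Cancellable : Carrier → Set
  Cancellable a = ∀ {b c} → a ⊗ b ≈ a ⊗ c → b ≈ c

  cancellable-1 : Cancellable 1#
  cancellable-1 p = R.trans (R.sym (R.*-identityˡ _)) (R.trans p (R.*-identityˡ _))

  cancellable-* : ∀ {a b} → Cancellable a → Cancellable b → Cancellable (a ⊗ b)
  cancellable-* p q e = q (p (R.trans (R.sym (R.*-assoc _ _ _)) (R.trans e (R.*-assoc _ _ _))))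

  cancellable-Πd : (∀ k → Cancellable (d (suc k))) → ∀ s k → Cancellable (Πd s k)
  cancellable-Πd p s zero    = cancellable-1
  cancellable-Πd p s (suc k) = cancellable-* (p s) (cancellable-Πd p (suc s) k)

  module _ (ℓ : ℕ) where

    Π∣ : (ℕ → Carrier) → ℕ → Carrier
    Π∣ f zero    = 1#
    Π∣ f (suc n) with ℓ ∣? suc n
    ... | yes _ = Π∣ f n ⊗ f (suc n)
    ... | no _  = Π∣ f n

    Π∣-yes : ∀ f n → ℓ ∣ suc n → Π∣ f (suc n) ≡ Π∣ f n ⊗ f (suc n)
    Π∣-yes f n ℓ∣ with ℓ ∣? suc n
    ... | yes _ = refl
    ... | no ℓ∤ = contradiction ℓ∣ ℓ∤

    Π∣-no : ∀ f n → ¬ ℓ ∣ suc n → Π∣ f (suc n) ≡ Π∣ f n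
    Π∣-no f n ℓ∤ with ℓ ∣? suc n
    ... | yes ℓ∣ = contradiction ℓ∣ ℓ∤
    ... | no _   = refl

    cancellable-Π∣ : ∀ f → (∀ k → Cancellable (f (suc k))) → ∀ n → Cancellable (Π∣ f n)
    cancellable-Π∣ f p zero    = cancellable-1
    cancellable-Π∣ f p (suc n) with ℓ ∣? suc n
    ... | yes _ = cancellable-* (cancellable-Π∣ f p n) (p n)
    ... | no _  = cancellable-Π∣ f p n

  Π∣-between : ∀ ℓ′ f k j → j ≤ ℓ′ → Π∣ (suc ℓ′) f (j + suc ℓ′ * k) ≡ Π∣ (suc ℓ′) f (suc ℓ′ * k)
  Π∣-between ℓ′ f k zero    _    = refl
  Π∣-between ℓ′ f k (suc j) j<ℓ′ = trans
    (Π∣-no (suc ℓ′) f (j + suc ℓ′ * k) λ ℓ∣ → >⇒∤ (s≤s j<ℓ′) (∣m+n∣m⇒∣n (subst (suc ℓ′ ∣_) (ℕₚ.+-comm (suc j) (suc ℓ′ * k)) ℓ∣) (m∣m*n k)))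
    (Π∣-between ℓ′ f k j (ℕₚ.<⇒≤ j<ℓ′))

  Π∣-multiple : ∀ ℓ′ f k → Π∣ (suc ℓ′) f (suc ℓ′ * suc k) ≈ Π∣ (suc ℓ′) f (suc ℓ′ * k) ⊗ f (suc ℓ′ * suc k)
  Π∣-multiple ℓ′ f k = subst (λ n → Π∣ (suc ℓ′) f n ≈ Π∣ (suc ℓ′) f (suc ℓ′ * k) ⊗ f n) (sym (ℕₚ.*-suc (suc ℓ′) k)) (R.reflexive (trans
    (Π∣-yes (suc ℓ′) f (ℓ′ + suc ℓ′ * k) (subst (suc ℓ′ ∣_) (ℕₚ.*-suc (suc ℓ′) k) (m∣m*n (suc k))))
    (cong (_⊗ f (suc ℓ′ + suc ℓ′ * k)) (Π∣-between ℓ′ f k ℓ′ ℕₚ.≤-refl))))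

  -- `𝔽` plays the role of f(q) ↦ f(q^ℓ), and `O k` that of the generating function for parts at
  -- most k. `O-no` is (1 - qᵖ) O p = (1 + qᵖ) O (p - 1), with p = k + 1, free of subtraction.
  module Quotient (ℓ′ : ℕ)
    (𝔽 : Carrier → Carrier) (𝔽-cong : ∀ {a b} → a ≈ b → 𝔽 a ≈ 𝔽 b)
    (𝔽-1 : 𝔽 1# ≈ 1#) (𝔽-* : ∀ a b → 𝔽 (a ⊗ b) ≈ 𝔽 a ⊗ 𝔽 b)
    (𝔽-u : ∀ p → 𝔽 (u p) ≈ u (suc ℓ′ * p)) (𝔽-d : ∀ p → 𝔽 (d p) ≈ d (suc ℓ′ * p))
    (u-cancellable : ∀ k → Cancellable (u (suc k))) (d-cancellable : ∀ k → Cancellable (d (suc k)))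
    (O : ℕ → Carrier) (O-zero : O 0 ≈ 1#)
    (O-yes : ∀ k → suc ℓ′ ∣ suc k → O (suc k) ≈ O k)
    (O-no : ∀ k → ¬ suc ℓ′ ∣ suc k → O (suc k) ≈ O k ⊕ q (suc k) ⊗ (O k ⊕ O (suc k)))
    where

    private ℓ = suc ℓ′

    Π∣u : ∀ k → Π∣ ℓ u (ℓ * k) ≈ 𝔽 (Πu k)
    Π∣u zero    rewrite ℕₚ.*-zeroʳ ℓ′ = R.sym 𝔽-1
    Π∣u (suc k) = R.trans (Π∣-multiple ℓ′ u k)
      (R.sym (R.trans (𝔽-* _ _) (R.*-cong (R.sym (Π∣u k)) (𝔽-u (suc k)))))

    Π∣d : ∀ k → Π∣ ℓ d (ℓ * k) ≈ 𝔽 (Πd 0 k)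
    Π∣d zero    rewrite ℕₚ.*-zeroʳ ℓ′ = R.sym 𝔽-1
    Π∣d (suc k) = R.trans (Π∣-multiple ℓ′ d k)
      (R.sym (R.trans (𝔽-cong (Πd-last 0 k)) (R.trans (𝔽-* _ _) (R.*-cong (R.sym (Π∣d k)) (𝔽-d (suc k))))))

    -- O n is the product of `u p` / `d p` over p ≤ n not divisible by ℓ; here all denominators are
    -- cleared.
    product-formula : ∀ n → O n ⊗ (Πd 0 n ⊗ Π∣ ℓ u n) ≈ Πu n ⊗ Π∣ ℓ d n
    product-formula zero = R.trans (R.*-congʳ O-zero) (R.*-congˡ (R.*-identityˡ _))
    product-formula (suc n) with ℓ ∣? suc n
    ... | yes ℓ∣ = begin
      O (suc n) ⊗ (Πd 0 (suc n) ⊗ (Π∣ ℓ u n ⊗ u (suc n)))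
        ≈⟨ R.*-cong (O-yes n ℓ∣) (R.*-congʳ (Πd-last 0 n)) ⟩
      O n ⊗ ((Πd 0 n ⊗ d (suc n)) ⊗ (Π∣ ℓ u n ⊗ u (suc n)))
        ≈⟨ solve₅ (O n ∷ Πd 0 n ∷ d (suc n) ∷ Π∣ ℓ u n ∷ u (suc n) ∷ []) (a :* ((b :* c) :* (e :* f))) ((a :* (b :* e)) :* (f :* c)) ⟩
      (O n ⊗ (Πd 0 n ⊗ Π∣ ℓ u n)) ⊗ (u (suc n) ⊗ d (suc n))
        ≈⟨ R.*-congʳ (product-formula n) ⟩
      (Πu n ⊗ Π∣ ℓ d n) ⊗ (u (suc n) ⊗ d (suc n))
        ≈⟨ solve₅ (Πu n ∷ Π∣ ℓ d n ∷ d (suc n) ∷ Π∣ ℓ u n ∷ u (suc n) ∷ []) ((a :* b) :* (f :* c)) ((a :* f) :* (b :* c)) ⟩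
      Πu (suc n) ⊗ (Π∣ ℓ d n ⊗ d (suc n)) ∎
      where
      a b c e f : Polynomial 5
      a = var 0F
      b = var 1F
      c = var 2F
      e = var 3F
      f = var 4F
    ... | no ℓ∤ = begin
      O (suc n) ⊗ (Πd 0 (suc n) ⊗ Π∣ ℓ u n)
        ≈⟨ R.*-congˡ (R.*-congʳ (Πd-last 0 n)) ⟩
      O (suc n) ⊗ ((Πd 0 n ⊗ d (suc n)) ⊗ Π∣ ℓ u n)
        ≈⟨ solve₅ (O (suc n) ∷ Πd 0 n ∷ q (suc n) ∷ Π∣ ℓ u n ∷ O n ∷ []) (a :* ((b :* (con 1 :+ :4∙ c)) :* e))
             ((a :+ :4∙ (c :* a)) :* (b :* e)) ⟩
      (O (suc n) ⊕ 4∙ (q (suc n) ⊗ O (suc n))) ⊗ (Πd 0 n ⊗ Π∣ ℓ u n)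
        ≈⟨ R.*-congʳ (R.+-congʳ (O-no n ℓ∤)) ⟩
      (O n ⊕ q (suc n) ⊗ (O n ⊕ O (suc n)) ⊕ 4∙ (q (suc n) ⊗ O (suc n))) ⊗ (Πd 0 n ⊗ Π∣ ℓ u n)
        ≈⟨ solve₅ (O (suc n) ∷ Πd 0 n ∷ q (suc n) ∷ Π∣ ℓ u n ∷ O n ∷ [])
             (((f :+ c :* (f :+ a)) :+ :4∙ (c :* a)) :* (b :* e)) ((f :* (b :* e)) :* (con 1 :+ c)) ⟩
      (O n ⊗ (Πd 0 n ⊗ Π∣ ℓ u n)) ⊗ u (suc n)
        ≈⟨ R.*-congʳ (product-formula n) ⟩
      (Πu n ⊗ Π∣ ℓ d n) ⊗ u (suc n)
        ≈⟨ solve₅ (Πu n ∷ Π∣ ℓ d n ∷ u (suc n) ∷ Π∣ ℓ u n ∷ O n ∷ []) ((a :* b) :* c) ((a :* c) :* b) ⟩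
      Πu (suc n) ⊗ Π∣ ℓ d n ∎
      where
      a b c e f : Polynomial 5
      a = var 0F
      b = var 1F
      c = var 2F
      e = var 3F
      f = var 4F

    -- Gauss' identity is used twice: at n = ℓ k, and at k under `𝔽`. The bound ℓ k is chosen
    -- because there the products over multiples of ℓ are exactly the images under `𝔽` of products
    -- up to k.
    quotient-formula : ∀ φ k → (∀ n → k ≤ n → φ ⊗ Πu n ≈ Πd 0 n) → φ ⊗ O (ℓ * k) ≈ 𝔽 φ
    quotient-formula φ k gauss = cancellable-Π∣ ℓ u u-cancellable n (cancellable-Πd d-cancellable 0 n (begin
      Πd 0 n ⊗ (Π∣ ℓ u n ⊗ (φ ⊗ O n))
        ≈⟨ solve₅ (Πd 0 n ∷ Π∣ ℓ u n ∷ φ ∷ O n ∷ []) (a :* (b :* (c :* e))) (c :* (e :* (a :* b))) ⟩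
      φ ⊗ (O n ⊗ (Πd 0 n ⊗ Π∣ ℓ u n))
        ≈⟨ R.*-congˡ (product-formula n) ⟩
      φ ⊗ (Πu n ⊗ Π∣ ℓ d n)
        ≈⟨ R.*-assoc _ _ _ ⟨
      (φ ⊗ Πu n) ⊗ Π∣ ℓ d n
        ≈⟨ R.*-cong (gauss n (ℕₚ.m≤n*m k ℓ)) (Π∣d k) ⟩
      Πd 0 n ⊗ 𝔽 (Πd 0 k)
        ≈⟨ R.*-congˡ (𝔽-cong (gauss k ℕₚ.≤-refl)) ⟨
      Πd 0 n ⊗ 𝔽 (φ ⊗ Πu k)
        ≈⟨ R.*-congˡ (R.trans (𝔽-* _ _) (R.trans (R.*-comm _ _) (R.*-congʳ (R.sym (Π∣u k))))) ⟩
      Πd 0 n ⊗ (Π∣ ℓ u n ⊗ 𝔽 φ) ∎))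
      where
      n = ℓ * k
      a b c e : Polynomial 4
      a = var 0F
      b = var 1F
      c = var 2F
      e = var 3F

  module Frobenius where
    open Sums R using (fifth-↑)

    module _ (f : ℕ → Carrier) (fifth-f : ∀ p → fifth (f p) ≈ f (5 * p)) where
      frobenius-family : ∀ α p → frobenius α (f p) ≈ f (5 ^ α * p)
      frobenius-family zero    p = R.reflexive (cong f (sym (ℕₚ.*-identityˡ p)))
      frobenius-family (suc α) p = R.trans (fifth-cong (frobenius-family α p))
        (R.trans (fifth-f (5 ^ α * p)) (R.reflexive (cong f (sym (ℕₚ.*-assoc 5 (5 ^ α) p)))))

    frobenius-u : ∀ α p → frobenius α (u p) ≈ u (5 ^ α * p)
    frobenius-u = frobenius-family u λ p → R.trans (fifth-+ _ _) (R.+-cong fifth-1 (fifth-↑ x p))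

    frobenius-d : ∀ α p → frobenius α (d p) ≈ d (5 ^ α * p)
    frobenius-d = frobenius-family d λ p → R.trans (fifth-+ _ _) (R.+-cong fifth-1
      (R.trans (fifth-+ _ _) (R.trans (R.+-cong (fifth-+ _ _) (fifth-+ _ _)) (4∙-cong (fifth-↑ x p)))))

-- Overpartition counts

sumFrom1-cong : ∀ {f g} n → (∀ c → f (suc c) ≡ g (suc c)) → sumFrom1 n f ≡ sumFrom1 n g
sumFrom1-cong zero    p = refl
sumFrom1-cong (suc n) p = cong₂ _+_ (sumFrom1-cong n p) (p n)

sumFrom1-head : ∀ n f → sumFrom1 (suc n) f ≡ f 1 + sumFrom1 n (f ∘ suc)
sumFrom1-head zero    f = ℕₚ.+-comm 0 (f 1)
sumFrom1-head (suc n) f = trans (cong (λ e → e + f (2 + n)) (sumFrom1-head n f)) (ℕₚ.+-assoc (f 1) _ _)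

sumFrom1-extend : ∀ {n f} m → (∀ c → n < c → f c ≡ 0) → sumFrom1 (m + n) f ≡ sumFrom1 n f
sumFrom1-extend zero    p = refl
sumFrom1-extend {n} {f} (suc m) p = trans (cong₂ _+_ (sumFrom1-extend m p) (p (suc (m + n)) (s≤s (ℕₚ.m≤n+m n m)))) (ℕₚ.+-identityʳ _)

module _ (A : ℕ → ℕ) (k : ℕ) where

  -- Reproduces the local `term` of `ovCount` for an arbitrary A, so that its sum can be studied on
  -- its own.
  removal : ℕ → ℕ → ℕ
  removal n c with c * suc k ≤? n
  ... | yes _ = A (n ∸ c * suc k)
  ... | no  _ = 0

  removal-big : ∀ n c → n < c * suc k → removal n c ≡ 0
  removal-big n c n< with c * suc k ≤? n
  ... | yes ≤n = contradiction ≤n (ℕₚ.<⇒≱ n<)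
  ... | no  _  = refl

  removal-suc : ∀ n c → removal (suc k + n) (suc c) ≡ removal n c
  removal-suc n c with suc c * suc k ≤? suc k + n | c * suc k ≤? n
  ... | yes _  | yes _  = cong A (ℕₚ.[m+n]∸[m+o]≡n∸o (suc k) n (c * suc k))
  ... | yes p  | no ¬q  = contradiction (ℕₚ.+-cancelˡ-≤ (suc k) _ _ p) ¬q
  ... | no ¬p  | yes q  = contradiction (ℕₚ.+-monoʳ-≤ (suc k) q) ¬p
  ... | no _   | no _   = refl

  removals : ℕ → ℕ
  removals n = sumFrom1 n (removal n)

  removals-small : ∀ n → n ≤ k → removals n ≡ 0
  removals-small n n≤k = trans (sumFrom1-cong n λ c → removal-big n (suc c) (ℕₚ.≤-trans (s≤s n≤k) (ℕₚ.m≤m+n (suc k) (c * suc k)))) (zeros n)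
    where
    zeros : ∀ n → sumFrom1 n (λ _ → 0) ≡ 0
    zeros zero    = refl
    zeros (suc n) = trans (ℕₚ.+-identityʳ _) (zeros n)

  -- With p = k + 1, the series R = Σ_{c ≥ 1} q^{cp} A satisfies R = qᵖ (A + R): one copy of the
  -- part p is taken out.
  removals-step : ∀ n → removals (suc k + n) ≡ A n + removals n
  removals-step n = begin
    removals (suc k + n)                                            ≡⟨ sumFrom1-head (k + n) (removal (suc k + n)) ⟩
    removal (suc k + n) 1 + sumFrom1 (k + n) (removal (suc k + n) ∘ suc)
      ≡⟨ cong₂ _+_ (removal-suc n 0) (sumFrom1-cong (k + n) λ c → removal-suc n (suc c)) ⟩
    A n + sumFrom1 (k + n) (removal n)                              ≡⟨ cong (λ e → A n + e) (sumFrom1-extend k λ c n<c → removal-big n c (ℕₚ.≤-trans n<c (ℕₚ.m≤m*n c (suc k)))) ⟩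
    A n + removals n                                                ∎
    where open ≡-Reasoning

module _ (ℓ k : ℕ) where

  ovCount-yes : ∀ n → ℓ ∣ suc k → ovCount ℓ (suc k) n ≡ ovCount ℓ k n
  ovCount-yes n ℓ∣ with ℓ ∣? suc k
  ... | yes _ = refl
  ... | no ℓ∤ = contradiction ℓ∣ ℓ∤

  -- The first component is the local function term of ovCount.
  ovCount-terms : ∀ n → ¬ ℓ ∣ suc k → ∃ λ t → ovCount ℓ (suc k) n ≡ ovCount ℓ k n + 2 * sumFrom1 n t
  ovCount-terms n ℓ∤ with ℓ ∣? suc k
  ... | yes ℓ∣ = contradiction ℓ∣ ℓ∤
  ... | no _   = _ , refl

  term≡removal : ∀ n ℓ∤ c → proj₁ (ovCount-terms n ℓ∤) c ≡ removal (ovCount ℓ k) k n c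
  term≡removal n ℓ∤ c with ℓ ∣? suc k
  ... | yes ℓ∣ = contradiction ℓ∣ ℓ∤
  ... | no _ with c * suc k ≤? n
  ...   | yes _ = refl
  ...   | no _  = refl

  ovCount-no : ∀ n → ¬ ℓ ∣ suc k → ovCount ℓ (suc k) n ≡ ovCount ℓ k n + 2 * removals (ovCount ℓ k) k n
  ovCount-no n ℓ∤ = trans (proj₂ (ovCount-terms n ℓ∤))
    (cong (λ e → ovCount ℓ k n + 2 * e) (sumFrom1-cong n λ c → term≡removal n ℓ∤ (suc c)))

  ovCount-small : ∀ n → n ≤ k → ovCount ℓ (suc k) n ≡ ovCount ℓ k n
  ovCount-small n n≤k = by-cases (ℓ ∣? suc k)
    where
    by-cases : Dec (ℓ ∣ suc k) → ovCount ℓ (suc k) n ≡ ovCount ℓ k n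
    by-cases (yes ℓ∣) = ovCount-yes n ℓ∣
    by-cases (no ℓ∤)  = trans (ovCount-no n ℓ∤)
      (trans (cong (λ e → ovCount ℓ k n + 2 * e) (removals-small (ovCount ℓ k) k n n≤k)) (ℕₚ.+-identityʳ _))

  -- From B = A + 2R and R = qᵖ (A + R) follows B = A + qᵖ (A + B), the recurrence needed for
  -- `O-no`.
  ovCount-step : ¬ ℓ ∣ suc k → ∀ n →
    ovCount ℓ (suc k) (suc k + n) ≡ ovCount ℓ k (suc k + n) + (ovCount ℓ k n + ovCount ℓ (suc k) n)
  ovCount-step ℓ∤ n = begin
    ovCount ℓ (suc k) (suc k + n)         ≡⟨ ovCount-no (suc k + n) ℓ∤ ⟩
    B + 2 * removals (ovCount ℓ k) k (suc k + n)
                                          ≡⟨ cong (λ e → B + 2 * e) (removals-step (ovCount ℓ k) k n) ⟩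
    B + 2 * (A + E)                       ≡⟨ solve 3 (λ b a e → b :+ con 2 :* (a :+ e) := b :+ (a :+ (a :+ con 2 :* e))) refl B A E ⟩
    B + (A + (A + 2 * E))                 ≡⟨ cong (λ e → B + (A + e)) (ovCount-no n ℓ∤) ⟨
    B + (A + ovCount ℓ (suc k) n)         ∎
    where
    open ≡-Reasoning
    open ℕ.+-*-Solver
    A = ovCount ℓ k n
    B = ovCount ℓ k (suc k + n)
    E = removals (ovCount ℓ k) k n

ovCount-stable : ∀ ℓ {m n} → n ≤ m → ovCount ℓ m n ≡ Abar ℓ n
ovCount-stable ℓ {m} {n} n≤m with o , refl ← ℕₚ.m≤n⇒∃[o]m+o≡n n≤m = trans (cong (λ m → ovCount ℓ m n) (ℕₚ.+-comm n o)) (go o)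
  where
  go : ∀ o → ovCount ℓ (o + n) n ≡ Abar ℓ n
  go zero    = refl
  go (suc o) = trans (ovCount-small ℓ (o + n) n (ℕₚ.m≤n+m n o)) (go o)

-- Power series modulo 5

open PowerSeries ℤ/5 public

private
  module ℤ/5 = CommutativeRing ℤ/5
  module ℙ = CommutativeRing (seriesRing everything)

infix 4 _≈₅?_

_≈₅?_ : ∀ m n → Dec (m ≈₅ n)
m ≈₅? n with m % 5 ≟ n % 5
... | yes p = yes (mod5 p)
... | no ¬p = no (¬p ∘ rem≡)

series₅ : Downset → CharFiveRing
series₅ D = record
  { commutativeRing = seriesRing D
  ; 5≈0 = agree λ { zero _ → mod5 refl ; (suc n) _ → mod5 refl } }

module Char5 (D : Downset) = CharFive (series₅ D)

ℤ/5₅ : CharFiveRing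
ℤ/5₅ = record { commutativeRing = ℤ/5 ; 5≈0 = mod5 refl }

module ℤ/5-Frobenius = CharFive ℤ/5₅

-- By induction on c through additivity of the fifth power. It makes F fix constants, as f⁵ = f(q⁵)
-- demands.
fermat : ∀ c → ℤ/5-Frobenius.fifth c ≈₅ c
fermat zero    = mod5 refl
fermat (suc c) = ℤ/5.trans (ℤ/5-Frobenius.fifth-+ 1 c) (ℤ/5.+-congˡ {1} (fermat c))

shift : Series → Series
shift f zero    = 0
shift f (suc n) = f n

X : Series
X = shift 𝟏

constant : ℕ → Series
constant c zero    = c
constant c (suc _) = 0

constant-⋆ : ∀ c f n → (constant c ⋆ f) n ≈₅ (c • f) n
constant-⋆ c f zero    = ℤ/5.refl
constant-⋆ c f (suc n) = ℤ/5.trans (ℤ/5.+-congˡ {c * f (suc n)} (at (ℙ.zeroˡ f) n tt)) (≡⇒≈₅ (ℕₚ.+-identityʳ _))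

X⋆≈shift : ∀ f → X ⋆ f ≈ shift f
X⋆≈shift f = agree λ where
  zero    _ → ℤ/5.refl
  (suc n) _ → at (ℙ.*-identityˡ f) n tt

head+tail : ∀ f → f ≈ constant (f 0) ⊞ X ⋆ tail f
head+tail f = agree λ where
  zero    _ → ≡⇒≈₅ (sym (ℕₚ.+-identityʳ _))
  (suc n) _ → ℤ/5.sym (at (X⋆≈shift (tail f)) (suc n) tt)

F : Series → Series
F = Char5.fifth everything

F-constant : ∀ c → F (constant c) ≈ constant c
F-constant c = ℙ.trans (times (times (times (times ℙ.refl)))) (agree λ { zero _ → fermat c ; (suc _) _ → ℤ/5.refl })
  where
  times : ∀ {f d} → f ≈ constant d → constant c ⋆ f ≈ constant (c * d)
  times {f} {d} p = agree λ where
    zero    _ → ℤ/5.*-congˡ {c} (at p 0 tt)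
    (suc n) _ → ℤ/5.trans (constant-⋆ c f (suc n))
                  (ℤ/5.trans (ℤ/5.*-congˡ {c} (at p (suc n) tt)) (≡⇒≈₅ (ℕₚ.*-zeroʳ c)))

shift⁵ : Series → Series
shift⁵ f = shift (shift (shift (shift (shift f))))

-- The recursive form of f(q)⁵ = f(q⁵) modulo 5, obtained by applying F to f = f 0 + q · `tail f`.
F-head+tail : ∀ f → F f ≈ constant (f 0) ⊞ X ⋆ (X ⋆ (X ⋆ (X ⋆ (X ⋆ F (tail f)))))
F-head+tail f = begin
  F f                                         ≈⟨ Char5.fifth-cong everything (head+tail f) ⟩
  F (constant (f 0) ⊞ X ⋆ tail f)             ≈⟨ Char5.fifth-+ everything (constant (f 0)) (X ⋆ tail f) ⟩
  F (constant (f 0)) ⊞ F (X ⋆ tail f)         ≈⟨ ℙ.+-cong (F-constant (f 0)) (Char5.fifth-* everything X (tail f)) ⟩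
  constant (f 0) ⊞ F X ⋆ F (tail f)           ≈⟨ ℙ.+-congˡ {constant (f 0)} (solve₅ (X ∷ F (tail f) ∷ [])
    ((x :* (x :* (x :* (x :* x)))) :* y) (x :* (x :* (x :* (x :* (x :* y)))))) ⟩
  constant (f 0) ⊞ X ⋆ (X ⋆ (X ⋆ (X ⋆ (X ⋆ F (tail f))))) ∎
  where
  open SetoidReasoning ℙ.setoid
  open Char5.Solver everything using (Polynomial; solve₅; var; _:+_; _:*_)
  x y : Polynomial 2
  x = var 0F
  y = var 1F

X⁵⋆≈shift⁵ : ∀ f → X ⋆ (X ⋆ (X ⋆ (X ⋆ (X ⋆ f)))) ≈ shift⁵ f
X⁵⋆≈shift⁵ f = step (step (step (step (X⋆≈shift f))))
  where
  step : ∀ {g h} → g ≈ h → X ⋆ g ≈ shift h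
  step {g} {h} p = ℙ.trans (ℙ.*-congˡ {X} p) (X⋆≈shift h)

F⋆ : ∀ f g → F f ⋆ g ≈ (f 0 • g) ⊞ shift⁵ (F (tail f) ⋆ g)
F⋆ f g = begin
  F f ⋆ g ≈⟨ ℙ.*-congʳ {g} (F-head+tail f) ⟩
  (constant (f 0) ⊞ X ⋆ (X ⋆ (X ⋆ (X ⋆ (X ⋆ F (tail f)))))) ⋆ g
    ≈⟨ solve₅ (X ∷ F (tail f) ∷ constant (f 0) ∷ g ∷ [])
        ((z :+ x :* (x :* (x :* (x :* (x :* y))))) :* w)
        (z :* w :+ x :* (x :* (x :* (x :* (x :* (y :* w)))))) ⟩
  constant (f 0) ⋆ g ⊞ X ⋆ (X ⋆ (X ⋆ (X ⋆ (X ⋆ (F (tail f) ⋆ g)))))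
    ≈⟨ ℙ.+-cong (agree λ n _ → constant-⋆ (f 0) g n) (X⁵⋆≈shift⁵ _) ⟩
  (f 0 • g) ⊞ shift⁵ (F (tail f) ⋆ g) ∎
  where
  open SetoidReasoning ℙ.setoid
  open Char5.Solver everything using (Polynomial; solve₅; var; _:+_; _:*_)
  x y z w : Polynomial 4
  x = var 0F
  y = var 1F
  z = var 2F
  w = var 3F

-- With `n * 5`, the index at `suc n` reduces to five successors, on which `shift⁵` computes.
U : Series → Series
U f n = f (n * 5)

U-cong : ∀ {f g} → f ≈ g → U f ≈ U g
U-cong p = agree λ n _ → at p (n * 5) tt

U-F⋆ : ∀ f g → U (F f ⋆ g) ≈ f ⋆ U g
U-F⋆ f g = agree λ n _ → go f n
  where
  go : ∀ f n → U (F f ⋆ g) n ≈₅ (f ⋆ U g) n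
  go f zero    = ℤ/5.trans (at (F⋆ f g) 0 tt) (≡⇒≈₅ (ℕₚ.+-identityʳ _))
  go f (suc n) = ℤ/5.trans (at (F⋆ f g) (suc n * 5) tt) (ℤ/5.+-congˡ {f 0 * g (suc n * 5)} (go (tail f) n))

Graded : ℕ → Series → Set
Graded r f = ∀ n → ¬ n ≈₅ r → f n ≈₅ 0

graded-≈₅ : ∀ {r s f} → r ≈₅ s → Graded r f → Graded s f
graded-≈₅ r≈s d n n≉s = d n λ n≈r → n≉s (ℤ/5.trans n≈r r≈s)

graded-⊞ : ∀ {r f g} → Graded r f → Graded r g → Graded r (f ⊞ g)
graded-⊞ d e n n≉r = ℤ/5.+-cong (d n n≉r) (e n n≉r)

private
  suc≈⇒≈+4 : ∀ {n r} → suc n ≈₅ r → n ≈₅ (r + 4)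
  suc≈⇒≈+4 {n} {r} p = ℤ/5.trans (mod5 lemma) (ℤ/5.+-congʳ {4} p)
    where
    lemma : n % 5 ≡ (suc n + 4) % 5
    lemma = trans (sym ([m+n]%n≡m%n n 5)) (cong (_% 5) (ℕₚ.+-suc n 4))

-- Dropping a factor q lowers the class by one, which modulo 5 is adding 4.
graded-tail : ∀ {r f} → Graded r f → Graded (r + 4) (tail f)
graded-tail d n n≉r+4 = d (suc n) (n≉r+4 ∘ suc≈⇒≈+4)

graded-⋆ : ∀ {r s f g} → Graded r f → Graded s g → Graded (r + s) (f ⋆ g)
graded-⋆ {r} {s} {f} {g} d e n n≉ = product f r d n n≉
  where
  vanishˡ : ∀ {a} b → a ≈₅ 0 → (a * b) ≈₅ 0
  vanishˡ b a≈0 = ℤ/5.*-congʳ {b} a≈0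

  term : ∀ f r → Graded r f → ∀ n → ¬ n ≈₅ (r + s) → (f 0 * g n) ≈₅ 0
  term f r d n n≉ with 0 ≈₅? r
  ... | no 0≉r  = vanishˡ (g n) (d 0 0≉r)
  ... | yes 0≈r = ℤ/5.trans (ℤ/5.*-congˡ {f 0} (e n λ n≈s → n≉ (ℤ/5.trans n≈s (ℤ/5.+-congʳ {s} 0≈r))))
                    (≡⇒≈₅ (ℕₚ.*-zeroʳ (f 0)))

  rearrange : ∀ r → (r + 4 + s + 1) ≈₅ (r + s)
  rearrange r = ℤ/5.trans (≡⇒≈₅ (solve 2 (λ r s → r :+ con 4 :+ s :+ con 1 := r :+ s :+ con 5) refl r s))
                  (mod5 ([m+n]%n≡m%n (r + s) 5))
    where open ℕ.+-*-Solver

  product : ∀ f r → Graded r f → ∀ n → ¬ n ≈₅ (r + s) → (f ⋆ g) n ≈₅ 0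
  product f r d zero    n≉ = term f r d 0 n≉
  product f r d (suc n) n≉ = ℤ/5.+-cong (term f r d (suc n) n≉)
    (product (tail f) (r + 4) (graded-tail d) n λ n≈ → n≉
      (ℤ/5.trans (≡⇒≈₅ (ℕₚ.+-comm 1 n)) (ℤ/5.trans (ℤ/5.+-congʳ {1} n≈) (rearrange r))))

graded-F : ∀ f → Graded 0 (F f)
graded-F f n n≉0 = ℤ/5.trans (at (ℙ.trans (F-head+tail f) (ℙ.+-congˡ {constant (f 0)} (X⁵⋆≈shift⁵ _))) n tt) (go n n≉0)
  where
  go : ∀ n → ¬ n ≈₅ 0 → (constant (f 0) ⊞ shift⁵ (F (tail f))) n ≈₅ 0
  go 0 n≉0 = ⊥-elim (n≉0 ℤ/5.refl)
  go 1 _   = ℤ/5.refl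
  go 2 _   = ℤ/5.refl
  go 3 _   = ℤ/5.refl
  go 4 _   = ℤ/5.refl
  go (suc (suc (suc (suc (suc n))))) n≉0 = graded-F (tail f) n (n≉0 ∘ mod5 ∘ trans 5+n≡n ∘ rem≡)
    where
    5+n≡n : (5 + n) % 5 ≡ n % 5
    5+n≡n = trans (cong (_% 5) (ℕₚ.+-comm 5 n)) ([m+n]%n≡m%n n 5)

U-graded : ∀ {r f} → Graded r f → ¬ 0 ≈₅ r → U f ≈ 𝟎
U-graded d 0≉r = agree λ n _ → d (n * 5) (0≉r ∘ ℤ/5.trans (ℤ/5.sym (mod5 (m*n%n≡0 n 5))))

-- The theta function

restrict : ∀ {f g} D → f ≈ g → f ≈[ D ] g
restrict D p = agree λ n _ → at p n tt

infixr 8 _^⋆_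

_^⋆_ : Series → ℕ → Series
_^⋆_ = power _⋆_ 𝟏

-- This is -q, spelled so that it coincides by definition with `-x` of Gauss' identity at x = `X`.
Y : Series
Y = (X ⊞ X) ⊞ (X ⊞ X)

X^⋆ : ∀ k f → X ^⋆ suc k ⋆ f ≈ shift (X ^⋆ k ⋆ f)
X^⋆ k f = ℙ.trans (ℙ.*-assoc X (X ^⋆ k) f) (X⋆≈shift (X ^⋆ k ⋆ f))

X^⋆-small : ∀ k f n → n < k → (X ^⋆ k ⋆ f) n ≈₅ 0
X^⋆-small (suc k) f zero    _         = at (X^⋆ k f) 0 tt
X^⋆-small (suc k) f (suc n) (s≤s n<k) = ℤ/5.trans (at (X^⋆ k f) (suc n) tt) (X^⋆-small k f n n<k)

X^⋆-large : ∀ k f n → (X ^⋆ k ⋆ f) (k + n) ≈₅ f n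
X^⋆-large zero    f n = at (ℙ.*-identityˡ f) n tt
X^⋆-large (suc k) f n = ℤ/5.trans (at (X^⋆ k f) (suc k + n) tt) (X^⋆-large k f n)

X^≈0 : ∀ {N k} → N ≤ k → X ^⋆ k ≈[ below N ] 𝟎
X^≈0 {N} {k} N≤k = agree λ n n<N → ℤ/5.trans (ℤ/5.sym (at (ℙ.*-identityʳ (X ^⋆ k)) n tt))
  (X^⋆-small k 𝟏 n (ℕₚ.<-≤-trans n<N N≤k))

Y⋆ : ∀ f n → (Y ⋆ f) n ≈₅ (4 • shift f) n
Y⋆ f n = ℤ/5.trans (at (ℙ.trans (ℙ.distribʳ f (X ⊞ X) (X ⊞ X)) (ℙ.+-cong X⊞X⋆ X⊞X⋆)) n tt)
  (≡⇒≈₅ (solve 1 (λ m → (m :+ m) :+ (m :+ m) := con 4 :* m) refl (shift f n)))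
  where
  open ℕ.+-*-Solver
  X⊞X⋆ : (X ⊞ X) ⋆ f ≈ shift f ⊞ shift f
  X⊞X⋆ = ℙ.trans (ℙ.distribʳ f X X) (ℙ.+-cong (X⋆≈shift f) (X⋆≈shift f))

Y^-support : ∀ k n → n ≢ k → (Y ^⋆ k) n ≈₅ 0
Y^-support zero    zero    0≢0 = ⊥-elim (0≢0 refl)
Y^-support zero    (suc n) _   = ℤ/5.refl
Y^-support (suc k) zero    _   = Y⋆ (Y ^⋆ k) 0
Y^-support (suc k) (suc n) n≢k = ℤ/5.trans (Y⋆ (Y ^⋆ k) (suc n)) (ℤ/5.*-congˡ {4} (Y^-support k n (n≢k ∘ cong suc)))

Y^≈0 : ∀ N → Y ^⋆ N ≈[ below N ] 𝟎
Y^≈0 N = agree λ n n<N → Y^-support N n (ℕₚ.<⇒≢ n<N)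

thetaPartial : (ℤ → ℕ) → ℕ → Series
thetaPartial w N = sumOver _⊞_ 𝟎 (box N) (λ k → Y ^⋆ w k)

-- A diagonal: when |k| ≤ w k, the coefficient of index n no longer changes once the box has size n.
theta : (ℤ → ℕ) → Series
theta w n = thetaPartial w n n

thetaPartial-stable : ∀ w → (∀ k → ∣ k ∣ ≤ w k) → ∀ {N n} → n ≤ N → thetaPartial w N n ≈₅ theta w n
thetaPartial-stable w ∣k∣≤w {N} {n} n≤N with o , refl ← ℕₚ.m≤n⇒∃[o]m+o≡n n≤N =
  ℤ/5.trans (≡⇒≈₅ (cong (λ N → thetaPartial w N n) (ℕₚ.+-comm n o))) (go o)
  where
  vanish : ∀ o k → ∣ k ∣ ≡ suc (o + n) → (Y ^⋆ w k) n ≈₅ 0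
  vanish o k ∣k∣≡ = Y^-support (w k) n (ℕₚ.<⇒≢ (ℕₚ.<-≤-trans (s≤s (ℕₚ.m≤n+m n o))
    (subst (_≤ w k) ∣k∣≡ (∣k∣≤w k))))
  go : ∀ o → thetaPartial w (o + n) n ≈₅ theta w n
  go zero    = ℤ/5.refl
  go (suc o) = ℤ/5.+-cong {(Y ^⋆ w (+ suc (o + n))) n} {0} (vanish o (+ suc (o + n)) refl)
    (ℤ/5.+-cong {(Y ^⋆ w -[1+ o + n ]) n} {0} (vanish o -[1+ o + n ] refl) (go o))

theta≈partial : ∀ w → (∀ k → ∣ k ∣ ≤ w k) → ∀ {M N} → M ≤ suc N → theta w ≈[ below M ] thetaPartial w N
theta≈partial w ∣k∣≤w M≤N = agree λ n n<M → ℤ/5.sym (thetaPartial-stable w ∣k∣≤w (ℕₚ.≤-pred (ℕₚ.≤-trans n<M M≤N)))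

theta-graded : ∀ w r → (∀ k → w k ≈₅ r) → Graded r (theta w)
theta-graded w r w≈r n n≉r = go (box n)
  where
  go : ∀ L → sumOver _⊞_ 𝟎 L (λ k → Y ^⋆ w k) n ≈₅ 0
  go []      = ℤ/5.refl
  go (k ∷ L) = ℤ/5.+-cong {(Y ^⋆ w k) n} {0} (Y^-support (w k) n λ { refl → n≉r (w≈r k) }) (go L)

+≡⇒≈₅ : ∀ a b m → + a ≡ + b ℤ.+ m ℤ.* + 5 → a ≈₅ b
+≡⇒≈₅ a b (+ m) eq = mod5 (trans (cong (_% 5) (ℤₚ.+-injective (trans eq (cong (λ z → + b ℤ.+ z) (sym (ℤₚ.pos-* m 5))))))
  ([m+kn]%n≡m%n b m 5))
+≡⇒≈₅ a b -[1+ m ] eq = ℤ/5.sym (+≡⇒≈₅ b a (+ suc m)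
  (trans (solve 2 (λ b k → b := (b :+ k) :- k) refl (+ b) (-[1+ m ] ℤ.* + 5)) (cong (ℤ._- -[1+ m ] ℤ.* + 5) (sym eq))))
  where open ℤ.+-*-Solver

sq-5k+c : ∀ c k → sq (5× k ⊹ c) ≈₅ sq c
sq-5k+c c k = +≡⇒≈₅ (sq (5× k ⊹ c)) (sq c) (+ 2 ℤ.* c ℤ.* k ℤ.+ + 5 ℤ.* k ℤ.* k)
  (trans (+sq (5× k ⊹ c)) (trans
    (solve 2 (λ c k → (c :+ k :* con (+ 5)) :* (c :+ k :* con (+ 5)) := c :* c :+ (con (+ 2) :* c :* k :+ con (+ 5) :* k :* k) :* con (+ 5)) refl c k)
    (cong (ℤ._+ (+ 2 ℤ.* c ℤ.* k ℤ.+ + 5 ℤ.* k ℤ.* k) ℤ.* + 5) (sym (+sq c)))))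
  where open ℤ.+-*-Solver

-- The signs (-1)ᵏ of Σ (-1)ᵏ q^{k²} are carried by Y = -q, because k² ≡ k (mod 2).
φ β γ : Series
φ = theta sq
β = theta λ k → sq (5× k ⊹ + 1)
γ = theta λ k → sq (5× k ⊹ + 2)

private
  ≤sq-5k+1 : ∀ k → ∣ k ∣ ≤ sq (5× k ⊹ + 1)
  ≤sq-5k+1 k = ∣k∣≤sq-5k+c (+ 1) k (s≤s z≤n)

  ≤sq-5k+2 : ∀ k → ∣ k ∣ ≤ sq (5× k ⊹ + 2)
  ≤sq-5k+2 k = ∣k∣≤sq-5k+c (+ 2) k ℕₚ.≤-refl

-- From truncated theta identities to full series

module Truncated (N : ℕ) where
  private
    D = below N
    module R = CommutativeRing (seriesRing D)
  open Char5 D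
  open ThetaIdentities (series₅ D) Y N (Y^≈0 N) renaming (φ to φ′)

  φ≈ : φ ≈[ D ] φ′
  φ≈ = theta≈partial sq ∣k∣≤sq (ℕₚ.n≤1+n N)

  β≈ : β ≈[ D ] θ (+ 1)
  β≈ = theta≈partial _ ≤sq-5k+1 (ℕₚ.n≤1+n N)

  γ≈ : γ ≈[ D ] θ (+ 2)
  γ≈ = theta≈partial _ ≤sq-5k+2 (ℕₚ.n≤1+n N)

  φ-split : φ ≈[ D ] F (F φ) ⊞ ((β ⊞ β) ⊞ (γ ⊞ γ))
  φ-split = R.trans φ≈ (R.trans φ-dissection (R.sym
    (R.+-cong (fifth-cong (fifth-cong φ≈)) (R.+-cong (R.+-cong β≈ β≈) (R.+-cong γ≈ γ≈)))))

  Fφ-square : F φ ⋆ F φ ≈[ D ] F (F φ) ⋆ F (F φ) ⊞ ((β ⋆ γ ⊞ β ⋆ γ) ⊞ (β ⋆ γ ⊞ β ⋆ γ))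
  Fφ-square = R.trans (R.*-cong (fifth-cong φ≈) (fifth-cong φ≈)) (R.trans fifth-φ² (R.sym
    (R.+-cong (R.*-cong (fifth-cong (fifth-cong φ≈)) (fifth-cong (fifth-cong φ≈))) (4∙-cong (R.*-cong β≈ γ≈)))))

untruncate : ∀ {f g} → (∀ N → f ≈[ below N ] g) → f ≈ g
untruncate p = agree λ n _ → at (p (suc n)) n ℕₚ.≤-refl

-- As f has constant term 1, the coefficients of g are determined one after another: at index n + 1
-- the product is f 0 · g (n + 1) plus terms in earlier coefficients of g.
⋆-cancelˡ : ∀ D {f g h} → f 0 ≈₅ 1 → f ⋆ g ≈[ D ] f ⋆ h → g ≈[ D ] h
⋆-cancelˡ D {f} {g} {h} f0≈1 fg≈fh = agree λ n n∈D → at (go n n∈D) n ℕₚ.≤-refl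
  where
  unit : ∀ {m n} → (f 0 * m) ≈₅ (f 0 * n) → m ≈₅ n
  unit {m} {n} p = ℤ/5.trans (ℤ/5.sym (≡⇒≈₅ (ℕₚ.*-identityˡ m))) (ℤ/5.trans (ℤ/5.*-congʳ {m} (ℤ/5.sym f0≈1))
    (ℤ/5.trans p (ℤ/5.trans (ℤ/5.*-congʳ {n} f0≈1) (≡⇒≈₅ (ℕₚ.*-identityˡ n)))))

  cancelʳ : ∀ a b {c d} → c ≈₅ d → (a + c) ≈₅ (b + d) → a ≈₅ b
  cancelʳ a b {c} {d} c≈d p = ∙-cancelʳ c a b (ℤ/5.trans p (ℤ/5.+-congˡ {b} (ℤ/5.sym c≈d)))
    where open import Algebra.Properties.AbelianGroup (ℤ/5.+-abelianGroup) using (∙-cancelʳ)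

  next : ∀ n → D ∋ suc n → g ≈[ below (suc n) ] h → g (suc n) ≈₅ h (suc n)
  next n n∈D below-n = unit (cancelʳ _ _ (at (CommutativeRing.*-congˡ (seriesRing (below (suc n))) {tail f} below-n) n ℕₚ.≤-refl)
    (at fg≈fh (suc n) n∈D))

  extend : ∀ n → g ≈[ below n ] h → g n ≈₅ h n → g ≈[ below (suc n) ] h
  extend n below-n at-n = agree λ i i<1+n → by-cases i (ℕₚ.m≤n⇒m<n∨m≡n (ℕₚ.≤-pred i<1+n))
    where
    by-cases : ∀ i → i < n ⊎ i ≡ n → g i ≈₅ h i
    by-cases i (inj₁ i<n)  = at below-n i i<n
    by-cases i (inj₂ refl) = at-n

  go : ∀ n → D ∋ n → g ≈[ below (suc n) ] h
  go zero    n∈D = extend 0 (agree λ _ ()) (unit (at fg≈fh 0 n∈D))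
  go (suc n) n∈D = extend (suc n) below-n (next n n∈D below-n)
    where below-n = go n (down D (ℕₚ.n≤1+n n) n∈D)

-- The overpartition series as a quotient of theta series

overpartitions : ℕ → Series
overpartitions ℓ n = Abar ℓ n

ovCount-series-no : ∀ ℓ k → ¬ ℓ ∣ suc k →
  ovCount ℓ (suc k) ≈ ovCount ℓ k ⊞ X ^⋆ suc k ⋆ (ovCount ℓ k ⊞ ovCount ℓ (suc k))
ovCount-series-no ℓ k ℓ∤ = agree λ n _ → by-cases n (ℕₚ.≤-<-connex n k)
  where
  A B : Series
  A = ovCount ℓ k
  B = ovCount ℓ (suc k)
  by-cases : ∀ n → n ≤ k ⊎ k < n → B n ≈₅ (A ⊞ X ^⋆ suc k ⋆ (A ⊞ B)) n
  by-cases n (inj₁ n≤k) = ℤ/5.trans (≡⇒≈₅ (trans (ovCount-small ℓ k n n≤k) (sym (ℕₚ.+-identityʳ _))))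
    (ℤ/5.+-congˡ {A n} (ℤ/5.sym (X^⋆-small (suc k) (A ⊞ B) n (s≤s n≤k))))
  by-cases n (inj₂ k<n) with m , refl ← ℕₚ.m≤n⇒∃[o]m+o≡n k<n =
    ℤ/5.trans (≡⇒≈₅ (ovCount-step ℓ k ℓ∤ m)) (ℤ/5.+-congˡ {A (suc k + m)} (ℤ/5.sym (X^⋆-large (suc k) (A ⊞ B) m)))


module _ (α : ℕ) where
  private
    ℓ = 5 ^ α

  module _ (k : ℕ) where
    private
      -- Modulo q^{k+1} every n ≥ k satisfies q^{n+1} = 0, which is what `gauss` asks for.
      D = below (suc k)
      module R = CommutativeRing (seriesRing D)
    open Char5 D
    open Gauss (series₅ D) X
    open OverpartitionProducts (series₅ D) X

    gauss-φ : ∀ n → k ≤ n → φ ⋆ Πu n ≈[ D ] Πd 0 n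
    gauss-φ n k≤n = R.trans (R.*-congʳ {Πu n} (theta≈partial sq ∣k∣≤sq (s≤s k≤n)))
      (gauss (thetaPartial sq) (R.+-identityʳ 𝟏) (λ _ → R.refl) n (X^≈0 (s≤s k≤n)))

    overpartitions≈ : overpartitions ℓ ≈[ D ] ovCount ℓ (ℓ * k)
    overpartitions≈ = agree λ n n<1+k → ≡⇒≈₅ (sym (ovCount-stable ℓ (ℕₚ.≤-trans (ℕₚ.≤-pred n<1+k) (ℕₚ.m≤n*m k ℓ {{ℕₚ.m^n≢0 5 α}}))))

    quotient-truncated : φ ⋆ overpartitions ℓ ≈[ D ] frobenius α φ
    -- `Quotient` takes ℓ as a successor, whereas `5 ^ α` does not reduce to one; hence the detour
    -- through its predecessor.
    quotient-truncated = R.trans (R.*-congˡ {φ} overpartitions≈) (subst Goal ℓ≡ (for-suc (ℓ ∸ 1) (sym ℓ≡)))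
      where
      ℓ≡ : suc (ℓ ∸ 1) ≡ ℓ
      ℓ≡ = ℕₚ.suc-pred ℓ {{ℕₚ.m^n≢0 5 α}}

      Goal : ℕ → Set
      Goal ℓ = φ ⋆ ovCount ℓ (ℓ * k) ≈[ D ] frobenius α φ

      for-suc : ∀ ℓ′ → ℓ ≡ suc ℓ′ → Goal (suc ℓ′)
      for-suc ℓ′ eq = Quotient.quotient-formula ℓ′ (frobenius α) (frobenius-cong α) (frobenius-1 α) (frobenius-* α)
        (λ p → R.trans (Frobenius.frobenius-u α p) (R.reflexive (cong (λ ℓ → u (ℓ * p)) eq)))
        (λ p → R.trans (Frobenius.frobenius-d α p) (R.reflexive (cong (λ ℓ → d (ℓ * p)) eq)))
        (λ k → ⋆-cancelˡ D {u (suc k)} ℤ/5.refl) (λ k → ⋆-cancelˡ D {d (suc k)} ℤ/5.refl)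
        (ovCount (suc ℓ′)) (agree λ { zero _ → ℤ/5.refl ; (suc n) _ → ℤ/5.refl })
        (λ k ℓ∣ → agree λ n _ → ≡⇒≈₅ (ovCount-yes (suc ℓ′) k n ℓ∣))
        (λ k ℓ∤ → restrict D (ovCount-series-no (suc ℓ′) k ℓ∤))
        φ k gauss-φ

  overpartition-quotient : φ ⋆ overpartitions ℓ ≈ Char5.frobenius everything α φ
  overpartition-quotient = agree λ n _ → at (quotient-truncated n) n ℕₚ.≤-refl

-- Sieving the overpartition series

seriesSieve : SieveRing
seriesSieve = record
  { charFiveRing = series₅ everything
  ; U = U ; U-cong = U-cong ; U-+ = λ _ _ → ℙ.refl
  ; U-1 = agree λ { zero _ → ℤ/5.refl ; (suc n) _ → ℤ/5.refl }
  ; U-F⊗ = U-F⋆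
  ; Graded = Graded
  ; graded-≈₅ = graded-≈₅
  ; graded-0 = λ _ _ → ℤ/5.refl
  ; graded-1 = λ { zero 0≉0 → ⊥-elim (0≉0 ℤ/5.refl) ; (suc n) _ → ℤ/5.refl }
  ; graded-+ = graded-⊞ ; graded-* = graded-⋆ ; graded-F = graded-F ; U-graded = U-graded }

φ-split : φ ≈ F (F φ) ⊞ ((β ⊞ β) ⊞ (γ ⊞ γ))
φ-split = untruncate Truncated.φ-split

Fφ-square : F φ ⋆ F φ ≈ F (F φ) ⋆ F (F φ) ⊞ ((β ⋆ γ ⊞ β ⋆ γ) ⊞ (β ⋆ γ ⊞ β ⋆ γ))
Fφ-square = untruncate Truncated.Fφ-square

β-graded : Graded 1 β
β-graded = theta-graded _ 1 (sq-5k+c (+ 1))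

γ-graded : Graded 4 γ
γ-graded = theta-graded _ 4 (sq-5k+c (+ 2))

open Dissection seriesSieve using (module Theta)
open Theta φ β γ φ-split Fφ-square β-graded γ-graded

U²ⁿ-coefficient : ∀ j f n → U²ⁿ j f n ≡ f (5 ^ (2 * j) * n)
U²ⁿ-coefficient zero    f n = cong f (sym (ℕₚ.*-identityˡ n))
U²ⁿ-coefficient (suc j) f n = trans (U²ⁿ-coefficient j (U (U f)) n) (cong f (begin
  5 ^ (2 * j) * n * 5 * 5          ≡⟨ solve 2 (λ a n → a :* n :* con 5 :* con 5 := con 5 :* (con 5 :* a) :* n) refl (5 ^ (2 * j)) n ⟩
  5 ^ (2 + 2 * j) * n              ≡⟨ cong (λ e → 5 ^ e * n) (ℕₚ.*-suc 2 j) ⟨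
  5 ^ (2 * suc j) * n              ∎))
  where
  open ≡-Reasoning
  open ℕ.+-*-Solver

dissected-vanishes : ∀ {f} → Dissected f → ∀ n → ¬ n ≈₅ 0 → ¬ n ≈₅ 2 → ¬ n ≈₅ 3 → f n ≈₅ 0
dissected-vanishes {f} d n n≉0 n≉2 n≉3 = ℤ/5.trans (at sum≈ n tt)
  (ℤ/5.+-cong (graded₀ n n≉0) (ℤ/5.+-cong (graded₂ n n≉2) (graded₃ n n≉3)))
  where open Dissected d

overpartitions-vanish : ∀ j m n → ¬ n ≈₅ 0 → ¬ n ≈₅ 2 → ¬ n ≈₅ 3 →
  Abar (5 ^ (3 + (j * 2 + suc m))) (5 ^ (2 * j) * n * 125) ≈₅ 0
overpartitions-vanish j m n n≉0 n≉2 n≉3 = ℤ/5.trans (≡⇒≈₅ (sym (trans (U²ⁿ-coefficient j (U (U (U G))) n)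
    (cong G (solve 1 (λ a → a :* con 5 :* con 5 :* con 5 := a :* con 125) refl (5 ^ (2 * j) * n))))))
  (dissected-vanishes (quotient-dissected (⋆-cancelˡ everything {φ} (mod5 refl)) j m (overpartition-quotient (3 + (j * 2 + suc m)))) n n≉0 n≉2 n≉3)
  where
  open ℕ.+-*-Solver
  G = overpartitions (5 ^ (3 + (j * 2 + suc m)))

theorem11 : (n α j i : ℕ) → 4 ≤ α → 2 * j + 4 ≤ α → (i ≡ 125 ⊎ i ≡ 500) →
    5 ∣ Abar (5 ^ α) (5 ^ (2 * j) * (625 * n + i))
theorem11 n α j i _ 2j+4≤α i≡ with m , refl ← ℕₚ.m≤n⇒∃[o]m+o≡n 2j+4≤α = go i≡
  where
  open ℕ.+-*-Solver

  α≡ : 3 + (j * 2 + suc m) ≡ 2 * j + 4 + m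
  α≡ = solve 2 (λ j m → con 3 :+ (j :* con 2 :+ (con 1 :+ m)) := con 2 :* j :+ con 4 :+ m) refl j m

  -- 625n + 125r = 125 (5n + r), with r = 1 for 125 and r = 4 for 500; these are the two classes
  -- absent from `Dissected`.
  vanish : ∀ r → ¬ r ≈₅ 0 → ¬ r ≈₅ 2 → ¬ r ≈₅ 3 → 5 ∣ Abar (5 ^ (2 * j + 4 + m)) (5 ^ (2 * j) * (625 * n + r * 125))
  vanish r r≉0 r≉2 r≉3 = subst (5 ∣_)
    (cong₂ (λ α → Abar (5 ^ α)) α≡ (solve 3 (λ a n r → a :* (r :+ n :* con 5) :* con 125 := a :* (con 625 :* n :+ r :* con 125)) refl (5 ^ (2 * j)) n r))
    (m%n≡0⇒n∣m _ 5 (rem≡ (overpartitions-vanish j m (r + n * 5) (r≉0 ∘ reduce) (r≉2 ∘ reduce) (r≉3 ∘ reduce))))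
    where
    reduce : ∀ {s} → (r + n * 5) ≈₅ s → r ≈₅ s
    reduce = ℤ/5.trans (ℤ/5.sym (mod5 ([m+kn]%n≡m%n r n 5)))

  go : i ≡ 125 ⊎ i ≡ 500 → 5 ∣ Abar (5 ^ (2 * j + 4 + m)) (5 ^ (2 * j) * (625 * n + i))
  go (inj₁ refl) = vanish 1 (λ { (mod5 ()) }) (λ { (mod5 ()) }) (λ { (mod5 ()) })
  go (inj₂ refl) = vanish 4 (λ { (mod5 ()) }) (λ { (mod5 ()) }) (λ { (mod5 ()) })
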